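{- For every $k\ge 3$ and every point $(x_1,\ldots,x_k)$ of the $k$-simplex, $$d_k(x_1,\ldots,x_k)\le\begin{cases}2.014096 & \text{if } x_1,x_2\le 6/11,\\ 11/12 & \text{otherwise.}\end{cases}$$
   Context: The $k$-simplex is $\{x\in\mathbb{R}^k: x\ge 0,\ \sum_i x_i=1\}$. Let $F(z)=\min\{(11/6)z,1\}$ for $z\in[0,1]$, and let $F'(z)=11/6$ for $z\in[0,6/11]$ and $F'(z)=0$ otherwise. For a point $(x_1,\dots,x_k)$ of the $k$-simplex define $$d_k(x_1,\ldots,x_k)=\frac{1}{k!}\sum_{\sigma}\Big(F'(x_1)\prod_{i:\sigma(i)<\sigma(1)}[1-F(x_i)]+F'(x_2)\prod_{i:\sigma(i)<\sigma(2)}[1-F(x_i)]\Big),$$ the sum being over all permutations $\sigma$ of $\{1,\dots,k\}$. (Interpretation: ICUT is the random cut of the simplex in which $\rho_1,\dots,\rho_k$ are chosen independently and uniformly in $[0,6/11]$ and, in a uniformly random order $\sigma$ of the terminals, terminal $i$ captures all not-yet-captured points with $x_i\ge\rho_i$; $d_k(x_1,\dots,x_k)$ is the density, i.e. expected number of cuts divided by length (half the $L_1$ norm), with which ICUT cuts an infinitesimal segment at $x$ parallel to the edge joining vertices $1$ and $2$ of the simplex.) -}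

module Defs where

open import Algebra.Bundles using (CommutativeRing)
open import Data.Bool.Base using (if_then_else_)
open import Data.Fin.Base using (Fin; zero; suc; fromℕ<; punchIn)
import Data.Fin.Properties as Fin
open import Data.Fin.Permutation as Perm using (Permutation′; _⟨$⟩ʳ_; insert; remove)
open import Data.List.Base using (List; []; _∷_; map; filter; foldr; concatMap; allFin; length)
open import Data.List.Properties using (length-map; length-++; length-tabulate)
open import Data.List.Relation.Unary.Any as Any using (Any; here)
import Data.List.Relation.Unary.Any.Properties as Any
open import Data.List.Membership.Propositional.Properties using (∈-allFin)
open import Data.Nat.Base as ℕ using (ℕ; zero; suc; _!)
import Data.Nat.Properties as ℕ
open import Data.Product.Base using (∃; _×_)
open import Data.Vec.Functional using (Vector)
open import Level using (Level; _⊔_) renaming (suc to lsuc)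
open import Relation.Binary.Bundles using (TotalOrder)
open import Relation.Binary.Core using (Rel)
open import Relation.Binary.Structures using (IsDecTotalOrder)
open import Relation.Binary.PropositionalEquality as ≡ using (_≡_)
open import Relation.Nullary.Decidable.Core using (does)
open import Relation.Nullary.Negation.Core using (¬_)
open import Relation.Unary using (Pred; Satisfiable)

-- The classical real numbers, axiomatised as a Dedekind-complete ordered
-- field with decidable order.  (Decidability is what makes the discontinuous
-- function F′ below definable.)

record RealNumbers (c ℓ : Level) : Set (lsuc (c ⊔ ℓ)) where
  infix  4 _≤_
  infix  8 _⁻¹
  field
    commutativeRing : CommutativeRing c ℓ

  open CommutativeRing commutativeRing public

  field
    _≤_             : Rel Carrier ℓ
    isDecTotalOrder : IsDecTotalOrder _≈_ _≤_
    +-monoʳ-≤       : ∀ z {x y} → x ≤ y → z + x ≤ z + y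
    *-nonNegative   : ∀ {x y} → 0# ≤ x → 0# ≤ y → 0# ≤ x * y
    0≉1             : ¬ (0# ≈ 1#)
    -- Total for convenience; nothing is assumed about 0# ⁻¹.
    _⁻¹             : Carrier → Carrier
    ⁻¹-inverseʳ     : ∀ {x} → ¬ (x ≈ 0#) → x * x ⁻¹ ≈ 1#

  UpperBound : Pred Carrier (c ⊔ ℓ) → Carrier → Set (c ⊔ ℓ)
  UpperBound P b = ∀ y → P y → y ≤ b

  field
    supremum : (P : Pred Carrier (c ⊔ ℓ)) → Satisfiable P → ∃ (UpperBound P) →
               ∃ λ s → UpperBound P s × (∀ b → UpperBound P b → s ≤ b)

  open IsDecTotalOrder isDecTotalOrder public
    using (_≤?_; isTotalOrder)

  totalOrder : TotalOrder c ℓ ℓ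
  totalOrder = record { isTotalOrder = isTotalOrder }

-- Every permutation of Fin n, listed exactly once: a permutation of
-- Fin (suc n) is determined by the image j of zero and the permutation
-- induced on the remaining points.

permutations : ∀ n → List (Permutation′ n)
permutations zero    = Perm.id ∷ []
permutations (suc n) = concatMap (λ j → map (insert zero j) (permutations n)) (allFin (suc n))

-- Together these two facts say that the list has no repetitions.

permutations-complete : ∀ {n} (π : Permutation′ n) → Any (Perm._≈ π) (permutations n)
permutations-complete {zero}  π = here λ ()
permutations-complete {suc n} π =
  Any.concatMap⁺ _ (Any.map (λ { ≡.refl → Any.map⁺ (Any.map step (permutations-complete (remove zero π))) })
                            (∈-allFin (π ⟨$⟩ʳ zero)))
  where
  step : ∀ {ρ} → ρ Perm.≈ remove zero π → insert zero (π ⟨$⟩ʳ zero) ρ Perm.≈ π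
  step {ρ} ρ≈ i = ≡.trans (insert-cong i) (Perm.insert-remove zero π i)
    where
    insert-cong : insert zero (π ⟨$⟩ʳ zero) ρ Perm.≈ insert zero (π ⟨$⟩ʳ zero) (remove zero π)
    insert-cong zero    = ≡.refl
    insert-cong (suc i) = ≡.cong (punchIn (π ⟨$⟩ʳ zero)) (ρ≈ i)

permutations-length : ∀ n → length (permutations n) ≡ n !
permutations-length zero    = ≡.refl
permutations-length (suc n) =
  ≡.trans (go (allFin (suc n)))
          (≡.cong₂ ℕ._*_ (length-tabulate {n = suc n} (λ i → i)) (permutations-length n))
  where
  go : ∀ js → length (concatMap (λ j → map (insert zero j) (permutations n)) js)
              ≡ length js ℕ.* length (permutations n)
  go []       = ≡.refl
  go (j ∷ js) = ≡.trans (length-++ (map (insert zero j) (permutations n)))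
                        (≡.cong₂ ℕ._+_ (length-map (insert zero j) (permutations n)) (go js))

-- Fin k is numbered from zero, so these are its elements 0 and 1.

terminal₁ terminal₂ : ∀ {k} → .(2 ℕ.≤ k) → Fin k
terminal₁ 2≤k = fromℕ< {0} (ℕ.<⇒≤ 2≤k)
terminal₂ 2≤k = fromℕ< {1} 2≤k

module Density {c ℓ} (ℝ : RealNumbers c ℓ) where

  open RealNumbers ℝ
  open import Algebra.Construct.NaturalChoice.Min totalOrder using (_⊓_)
  open import Algebra.Properties.Semiring.Mult semiring using () renaming (_×_ to _·_)
  import Algebra.Properties.Semiring.Sum semiring as Sum

  infixl 7 _/_

  fromℕ : ℕ → Carrier
  fromℕ n = n · 1#

  -- The real number m/n; only used with n ≠ 0.
  _/_ : ℕ → ℕ → Carrier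
  m / n = fromℕ m * fromℕ n ⁻¹

  record InSimplex {k} (x : Vector Carrier k) : Set ℓ where
    field
      nonNegative : ∀ i → 0# ≤ x i
      sum≈1       : Sum.sum x ≈ 1#

  F : Carrier → Carrier
  F z = (11 / 6 * z) ⊓ 1#

  F′ : Carrier → Carrier
  F′ z = if does (z ≤? 6 / 11) then 11 / 6 else 0#

  ∑[_] ∏[_] : List Carrier → Carrier
  ∑[_] = foldr _+_ 0#
  ∏[_] = foldr _*_ 1#

  -- The summand F′(x_j) ∏_{i : σ(i) < σ(j)} [1 − F(x_i)] of d for j = 1, 2.
  term : ∀ {k} → Vector Carrier k → Permutation′ k → Fin k → Carrier
  term {k} x σ j =
    F′ (x j) * ∏[ map (λ i → 1# - F (x i)) (filter (λ i → (σ ⟨$⟩ʳ i) Fin.<? (σ ⟨$⟩ʳ j)) (allFin k)) ]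

  d : ∀ {k} → .(2 ℕ.≤ k) → Vector Carrier k → Carrier
  d {k} 2≤k x =
    1 / (k !) * ∑[ map (λ σ → term x σ (terminal₁ 2≤k) + term x σ (terminal₂ 2≤k)) (permutations k) ]

{-# OPTIONS --safe #-}

-- If terminal i arrives at a uniform random time in [0,1], the random order becomes a product of independent events:
-- the terminal arriving at time t precedes exactly those with arrival time below t, so d is the sum over j = 1, 2 of
--   F′(x_j) ∫₀¹ ∏_{i≠j} (1 − t y_i) dt,   y_i = F(x_i).
-- When some y_i = 1 the integral is at most ∫ (1 − t) dt = 1/2.  Otherwise y_i = (11/6) x_i for all i, and with
-- v = ∑_{i≥3} x_i, κ = 11/6, the two integrals add up to ∫ (2 − κ(1−v)t) ∏_{i≥3} (1 − t y_i) dt.  The product is at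
-- most e^(−κvt), and indeed at most every Taylor polynomial of e^(−κvt) of even degree; degree 6 leaves a polynomial
-- inequality in v on [0,1], whose maximum 2.0140950… near v = 0.1608 is below 2.014096.
--
-- Integrals enter only through moments: a sequence μ plays the role of j ↦ ∫ t^j dμ, and positivity of the measure
-- that of Hausdorff's complete monotonicity, which for μ j = 1/(j+1) is read off the sums over permutations.

module Submission where

open import Algebra.Bundles using (RawRing)
open import Algebra.Solver.Ring.AlmostCommutativeRing using (AlmostCommutativeRing; fromCommutativeRing; _-Raw-AlmostCommutative⟶_; Induced-equivalence)
open import Data.Bool.Base using (true; false; if_then_else_)
open import Data.Fin.Base as Fin using (Fin; zero; suc; toℕ; punchIn; inject₁)
import Data.Fin.Properties as Fin
open import Data.Fin.Permutation using (Permutation′; _⟨$⟩ʳ_; insert)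
open import Data.Integer.Base as ℤ using (ℤ; +_; -[1+_])
import Data.Integer.Properties as ℤ
open import Data.List.Base as List using (List; []; _∷_; map; filter; concatMap; tabulate)
open import Data.List.Properties using (map-++; map-∘)
open import Data.Maybe.Base using (just; nothing)
open import Data.Nat.Base as ℕ using (ℕ; zero; suc; _!; z≤n; s≤s; z<s; s<s; s<s⁻¹)
open import Data.Nat.Properties using (<⇒≤)
import Data.Nat.Properties as ℕ
open import Data.Nat.Tactic.RingSolver using (solve-∀)
open import Data.Product.Base using (_×_; _,_; proj₁; proj₂; ∃)
open import Data.Sum.Base using (_⊎_; inj₁; inj₂; [_,_]′)
open import Data.Vec.Functional using (Vector; head; tail)
open import Function.Base using (_∘_; id)
open import Function.Bundles using (_⇔_; mk⇔; Equivalence)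
open import Level using (_⊔_)
open import Relation.Binary.Bundles using (TotalOrder)
open import Relation.Binary.Definitions using (WeaklyDecidable)
open import Relation.Binary.PropositionalEquality as ≡ using (_≡_)
open import Relation.Nullary.Decidable using (Dec; does; yes; no; does-⇔; dec-true; dec-false)
open import Relation.Nullary.Negation.Core using (¬_; contradiction)
open import Relation.Unary using (Pred; Decidable)
open import Defs

module IntegerSolver {c ℓ} (ℝ : RealNumbers c ℓ) where
  open RealNumbers ℝ hiding (zero)
  open Density ℝ using (fromℕ)
  open import Algebra.Properties.Ring ring using (-0#≈0#; -‿involutive; -‿distribˡ-*)
  open import Algebra.Properties.AbelianGroup +-abelianGroup using (⁻¹-∙-comm)
  open import Algebra.Properties.Semiring.Mult semiring using (×-homo-+; ×1-homo-*)
  open import Relation.Binary.Reasoning.Setoid setoid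

  fromℕ-+ : ∀ m n → fromℕ (m ℕ.+ n) ≈ fromℕ m + fromℕ n
  fromℕ-+ = ×-homo-+ 1#

  fromℕ-* : ∀ m n → fromℕ (m ℕ.* n) ≈ fromℕ m * fromℕ n
  fromℕ-* = ×1-homo-*

  -- fromℕ is unary: unfolding it at the numerals of the certificate below would not terminate in practice.
  abstract
    fromℤ : ℤ → Carrier
    fromℤ (+ n)    = fromℕ n
    fromℤ -[1+ n ] = - fromℕ (suc n)

    fromℤ-pos : ∀ n → fromℤ (+ n) ≈ fromℕ n
    fromℤ-pos n = refl

    fromℤ-0 : fromℤ (+ 0) ≈ 0#
    fromℤ-0 = refl

    fromℤ-1 : fromℤ (+ 1) ≈ 1#
    fromℤ-1 = +-identityʳ 1#

    fromℤ-neg : ∀ i → fromℤ (ℤ.- i) ≈ - fromℤ i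
    fromℤ-neg (+ zero)  = sym -0#≈0#
    fromℤ-neg (+ suc n) = refl
    fromℤ-neg -[1+ n ]  = sym (-‿involutive _)

    fromℤ-⊖ : ∀ m n → fromℤ (m ℤ.⊖ n) ≈ fromℕ m - fromℕ n
    fromℤ-⊖ m       zero    = trans (sym (+-identityʳ _)) (+-congˡ (sym -0#≈0#))
    fromℤ-⊖ zero    (suc n) = sym (+-identityˡ _)
    fromℤ-⊖ (suc m) (suc n) = begin
      fromℤ (suc m ℤ.⊖ suc n)              ≡⟨ ≡.cong fromℤ (ℤ.[1+m]⊖[1+n]≡m⊖n m n) ⟩
      fromℤ (m ℤ.⊖ n)                      ≈⟨ fromℤ-⊖ m n ⟩
      fromℕ m - fromℕ n                    ≈⟨ +-identityˡ _ ⟨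
      0# + (fromℕ m - fromℕ n)             ≈⟨ +-congʳ (-‿inverseʳ 1#) ⟨
      (1# - 1#) + (fromℕ m - fromℕ n)      ≈⟨ +-assoc _ _ _ ⟩
      1# + (- 1# + (fromℕ m - fromℕ n))    ≈⟨ +-congˡ (+-assoc _ _ _) ⟨
      1# + ((- 1# + fromℕ m) - fromℕ n)    ≈⟨ +-congˡ (+-congʳ (+-comm _ _)) ⟩
      1# + ((fromℕ m - 1#) - fromℕ n)      ≈⟨ +-congˡ (+-assoc _ _ _) ⟩
      1# + (fromℕ m + (- 1# - fromℕ n))    ≈⟨ +-assoc _ _ _ ⟨
      (1# + fromℕ m) + (- 1# - fromℕ n)    ≈⟨ +-congˡ (⁻¹-∙-comm 1# (fromℕ n)) ⟩
      fromℕ (suc m) - fromℕ (suc n)        ∎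

    fromℤ-+ : ∀ i j → fromℤ (i ℤ.+ j) ≈ fromℤ i + fromℤ j
    fromℤ-+ (+ m)    (+ n)    = fromℕ-+ m n
    fromℤ-+ (+ m)    -[1+ n ] = fromℤ-⊖ m (suc n)
    fromℤ-+ -[1+ m ] (+ n)    = trans (fromℤ-⊖ n (suc m)) (+-comm _ _)
    fromℤ-+ -[1+ m ] -[1+ n ] = begin
      - fromℕ (suc (suc (m ℕ.+ n)))      ≡⟨ ≡.cong (λ k → - fromℕ (suc k)) (ℕ.+-suc m n) ⟨
      - fromℕ (suc m ℕ.+ suc n)          ≈⟨ -‿cong (fromℕ-+ (suc m) (suc n)) ⟩
      - (fromℕ (suc m) + fromℕ (suc n))  ≈⟨ ⁻¹-∙-comm _ _ ⟨
      - fromℕ (suc m) - fromℕ (suc n)    ∎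

    fromℤ-pos-* : ∀ m j → fromℤ (+ m ℤ.* j) ≈ fromℕ m * fromℤ j
    fromℤ-pos-* zero    j = trans (reflexive (≡.cong fromℤ (ℤ.*-zeroˡ j))) (sym (zeroˡ _))
    fromℤ-pos-* (suc m) j = begin
      fromℤ (+ suc m ℤ.* j)                ≡⟨ ≡.cong fromℤ (ℤ.suc-* (+ m) j) ⟩
      fromℤ (j ℤ.+ + m ℤ.* j)              ≈⟨ fromℤ-+ j (+ m ℤ.* j) ⟩
      fromℤ j + fromℤ (+ m ℤ.* j)          ≈⟨ +-cong (sym (*-identityˡ _)) (fromℤ-pos-* m j) ⟩
      1# * fromℤ j + fromℕ m * fromℤ j     ≈⟨ distribʳ _ _ _ ⟨
      fromℕ (suc m) * fromℤ j              ∎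

    fromℤ-* : ∀ i j → fromℤ (i ℤ.* j) ≈ fromℤ i * fromℤ j
    fromℤ-* (+ m)    j = fromℤ-pos-* m j
    fromℤ-* -[1+ m ] j = begin
      fromℤ (-[1+ m ] ℤ.* j)               ≡⟨ ≡.cong fromℤ (ℤ.neg-distribˡ-* (+ suc m) j) ⟨
      fromℤ (ℤ.- (+ suc m ℤ.* j))          ≈⟨ fromℤ-neg (+ suc m ℤ.* j) ⟩
      - fromℤ (+ suc m ℤ.* j)              ≈⟨ -‿cong (fromℤ-pos-* (suc m) j) ⟩
      - (fromℕ (suc m) * fromℤ j)          ≈⟨ -‿distribˡ-* _ _ ⟩
      - fromℕ (suc m) * fromℤ j            ∎

  ℤ-rawRing : RawRing _ _
  ℤ-rawRing = record { Carrier = ℤ ; _≈_ = _≡_ ; _+_ = ℤ._+_ ; _*_ = ℤ._*_ ; -_ = ℤ.-_ ; 0# = + 0 ; 1# = + 1 }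

  almostCommutativeRing : AlmostCommutativeRing c ℓ
  almostCommutativeRing = fromCommutativeRing commutativeRing

  fromℤ-homomorphism : ℤ-rawRing -Raw-AlmostCommutative⟶ almostCommutativeRing
  fromℤ-homomorphism = record
    { ⟦_⟧    = fromℤ
    ; +-homo = fromℤ-+
    ; *-homo = fromℤ-*
    ; -‿homo = fromℤ-neg
    ; 0-homo = fromℤ-0
    ; 1-homo = fromℤ-1
    }

  fromℤ-≟ : WeaklyDecidable (Induced-equivalence fromℤ-homomorphism)
  fromℤ-≟ i j with i ℤ.≟ j
  ... | yes i≡j = just (reflexive (≡.cong fromℤ i≡j))
  ... | no _    = nothing

  open import Algebra.Solver.Ring ℤ-rawRing almostCommutativeRing fromℤ-homomorphism fromℤ-≟ public
    using (solve; _:=_; _:+_; _:*_; _:-_; :-_; _:^_; con; Polynomial)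

module OrderedField {c ℓ} (ℝ : RealNumbers c ℓ) where
  open RealNumbers ℝ hiding (zero)
  open Density ℝ using (fromℕ; _/_)
  open IntegerSolver ℝ
  open TotalOrder totalOrder public
    using (poset; total; antisym; ≤-respˡ-≈; ≤-respʳ-≈)
    renaming (refl to ≤-refl; reflexive to ≤-reflexive; trans to ≤-trans)

  ≤⇒0≤- : ∀ {x y} → x ≤ y → 0# ≤ y - x
  ≤⇒0≤- {x} {y} x≤y = ≤-respˡ-≈ (-‿inverseˡ x) (≤-respʳ-≈ (+-comm _ _) (+-monoʳ-≤ (- x) x≤y))

  0≤-⇒≤ : ∀ {x y} → 0# ≤ y - x → x ≤ y
  0≤-⇒≤ {x} {y} 0≤ = ≤-respˡ-≈ (+-identityʳ x) (≤-respʳ-≈ (solve 2 (λ x y → x :+ (y :- x) := y) refl x y) (+-monoʳ-≤ x 0≤))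

  +-mono-≤ : ∀ {x y u v} → x ≤ y → u ≤ v → x + u ≤ y + v
  +-mono-≤ {x} {y} {u} {v} x≤y u≤v =
    ≤-trans (+-monoʳ-≤ x u≤v) (≤-respˡ-≈ (+-comm v x) (≤-respʳ-≈ (+-comm v y) (+-monoʳ-≤ v x≤y)))

  +-nonNegative : ∀ {x y} → 0# ≤ x → 0# ≤ y → 0# ≤ x + y
  +-nonNegative 0≤x 0≤y = ≤-respˡ-≈ (+-identityʳ 0#) (+-mono-≤ 0≤x 0≤y)

  x≤x+y : ∀ {x y} → 0# ≤ y → x ≤ x + y
  x≤x+y {x} 0≤y = ≤-respˡ-≈ (+-identityʳ x) (+-monoʳ-≤ x 0≤y)

  x-y≤x : ∀ {x y} → 0# ≤ y → x - y ≤ x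
  x-y≤x {x} {y} 0≤y = 0≤-⇒≤ (≤-respʳ-≈ (solve 2 (λ x y → y := x :- (x :- y)) refl x y) 0≤y)

  *-monoˡ-≤ : ∀ {x y z} → 0# ≤ z → x ≤ y → z * x ≤ z * y
  *-monoˡ-≤ {x} {y} {z} 0≤z x≤y =
    0≤-⇒≤ (≤-respʳ-≈ (solve 3 (λ x y z → z :* (y :- x) := z :* y :- z :* x) refl x y z) (*-nonNegative 0≤z (≤⇒0≤- x≤y)))

  0≤x² : ∀ x → 0# ≤ x * x
  0≤x² x with total 0# x
  ... | inj₁ 0≤x = *-nonNegative 0≤x 0≤x
  ... | inj₂ x≤0 = ≤-respʳ-≈ (solve 1 (λ x → (con (+ 0) :- x) :* (con (+ 0) :- x) := x :* x) refl x) (*-nonNegative 0≤-x 0≤-x)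
    where 0≤-x = ≤-respʳ-≈ (+-congʳ (sym fromℤ-0)) (≤⇒0≤- x≤0)

  0≤1 : 0# ≤ 1#
  0≤1 = ≤-respʳ-≈ (*-identityˡ 1#) (0≤x² 1#)

  1≰0 : ¬ 1# ≤ 0#
  1≰0 1≤0 = 0≉1 (antisym 0≤1 1≤0)

  fromℕ-nonNegative : ∀ n → 0# ≤ fromℕ n
  fromℕ-nonNegative zero    = ≤-refl
  fromℕ-nonNegative (suc n) = +-nonNegative 0≤1 (fromℕ-nonNegative n)

  fromℕ-suc≉0 : ∀ n → ¬ fromℕ (suc n) ≈ 0#
  fromℕ-suc≉0 n ≈0 = 1≰0 (≤-respʳ-≈ ≈0 (x≤x+y (fromℕ-nonNegative n)))

  inverseʳ : ∀ n .{{_ : ℕ.NonZero n}} → fromℕ n * fromℕ n ⁻¹ ≈ 1#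
  inverseʳ (suc n) = ⁻¹-inverseʳ (fromℕ-suc≉0 n)

  inverse-nonNegative : ∀ n .{{_ : ℕ.NonZero n}} → 0# ≤ fromℕ n ⁻¹
  inverse-nonNegative n with total 0# (fromℕ n ⁻¹)
  ... | inj₁ 0≤ = 0≤
  ... | inj₂ ≤0 = contradiction (≤-respˡ-≈ (inverseʳ n) (≤-respʳ-≈ (zeroʳ _) (*-monoˡ-≤ (fromℕ-nonNegative n) ≤0))) 1≰0

  inverse-cancelˡ : ∀ n .{{_ : ℕ.NonZero n}} x → fromℕ n ⁻¹ * (fromℕ n * x) ≈ x
  inverse-cancelˡ n x = trans (solve 3 (λ i a x → i :* (a :* x) := a :* i :* x) refl (fromℕ n ⁻¹) (fromℕ n) x)
                              (trans (*-congʳ (inverseʳ n)) (*-identityˡ x))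

  *-cancelˡ-≈ : ∀ n .{{_ : ℕ.NonZero n}} {x y} → fromℕ n * x ≈ fromℕ n * y → x ≈ y
  *-cancelˡ-≈ n {x} {y} eq = trans (sym (inverse-cancelˡ n x)) (trans (*-congˡ eq) (inverse-cancelˡ n y))

  *-cancelˡ-≤ : ∀ n .{{_ : ℕ.NonZero n}} {x y} → fromℕ n * x ≤ fromℕ n * y → x ≤ y
  *-cancelˡ-≤ n {x} {y} le =
    ≤-respˡ-≈ (inverse-cancelˡ n x) (≤-respʳ-≈ (inverse-cancelˡ n y) (*-monoˡ-≤ (inverse-nonNegative n) le))

  *-/ : ∀ m n .{{_ : ℕ.NonZero n}} → fromℕ n * (m / n) ≈ fromℕ m
  *-/ m n = trans (solve 3 (λ a b i → b :* (a :* i) := a :* (b :* i)) refl (fromℕ m) (fromℕ n) (fromℕ n ⁻¹))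
                  (trans (*-congˡ (inverseʳ n)) (*-identityʳ _))

module Exponential {c ℓ} (ℝ : RealNumbers c ℓ) where
  open RealNumbers ℝ hiding (zero)
  open Density ℝ using (fromℕ)
  open OrderedField ℝ
  open IntegerSolver ℝ
  open import Relation.Binary.Reasoning.Setoid setoid

  1/1+ : ℕ → Carrier
  1/1+ n = fromℕ (suc n) ⁻¹

  _^_/! : Carrier → ℕ → Carrier
  x ^ zero  /! = 1#
  x ^ suc j /! = x * 1/1+ j * x ^ j /!

  -- On the moments μ j = ∫ t^j dμ this is the integral of the Taylor polynomial of e^(x t) of degree N.
  exp : ℕ → Carrier → (ℕ → Carrier) → Carrier
  exp zero    x μ = μ 0
  exp (suc N) x μ = exp N x μ + x ^ suc N /! * μ (suc N)

  suc-^/! : ∀ j x → fromℕ (suc j) * x ^ suc j /! ≈ x * x ^ j /!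
  suc-^/! j x = trans (solve 4 (λ a x i p → a :* (x :* i :* p) := a :* i :* (x :* p)) refl (fromℕ (suc j)) x (1/1+ j) (x ^ j /!))
                      (trans (*-congʳ (inverseʳ (suc j))) (*-identityˡ _))

  exp-cong : ∀ N {x μ ν} → (∀ j → μ j ≈ ν j) → exp N x μ ≈ exp N x ν
  exp-cong zero    μ≈ν = μ≈ν 0
  exp-cong (suc N) μ≈ν = +-cong (exp-cong N μ≈ν) (*-congˡ (μ≈ν (suc N)))

  exp-linear : ∀ N x a {μ ν ξ} → (∀ j → ξ j ≈ μ j + a * ν j) → exp N x ξ ≈ exp N x μ + a * exp N x ν
  exp-linear zero    x a eq = eq 0
  exp-linear (suc N) x a {μ} {ν} {ξ} eq = begin
    exp N x ξ + p * ξ (suc N)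
      ≈⟨ +-cong (exp-linear N x a eq) (*-congˡ (eq (suc N))) ⟩
    (exp N x μ + a * exp N x ν) + p * (μ (suc N) + a * ν (suc N))
      ≈⟨ solve 6 (λ e f a p m n → (e :+ a :* f) :+ p :* (m :+ a :* n) := (e :+ p :* m) :+ a :* (f :+ p :* n)) refl
           (exp N x μ) (exp N x ν) a p (μ (suc N)) (ν (suc N)) ⟩
    exp (suc N) x μ + a * exp (suc N) x ν ∎
    where p = x ^ suc N /!

  -- ∑ over q ≤ M of z^(i+q)/(i+q)! · x^(M−q)/(M−q)!
  convolution : Carrier → Carrier → ℕ → ℕ → Carrier
  convolution x z i zero    = z ^ i /! * 1#
  convolution x z i (suc M) = z ^ i /! * x ^ suc M /! + convolution x z (suc i) M

  term-suc : ∀ x z i M → (fromℕ (suc i) + fromℕ (suc M)) * (z ^ suc i /! * x ^ suc M /!) ≈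
                         z * (z ^ i /! * x ^ suc M /!) + x * (z ^ suc i /! * x ^ M /!)
  term-suc x z i M = begin
    (a + b) * (p * q)      ≈⟨ solve 4 (λ a b p q → (a :+ b) :* (p :* q) := (a :* p) :* q :+ p :* (b :* q)) refl a b p q ⟩
    a * p * q + p * (b * q) ≈⟨ +-cong (*-congʳ (suc-^/! i z)) (*-congˡ (suc-^/! M x)) ⟩
    z * z ^ i /! * q + p * (x * x ^ M /!)
      ≈⟨ solve 6 (λ z r q p x t → z :* r :* q :+ p :* (x :* t) := z :* (r :* q) :+ x :* (p :* t)) refl z (z ^ i /!) q p x (x ^ M /!) ⟩
    z * (z ^ i /! * q) + x * (p * x ^ M /!) ∎
    where
    a = fromℕ (suc i)
    b = fromℕ (suc M)
    p = z ^ suc i /!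
    q = x ^ suc M /!

  shift-suc : ∀ i M → fromℕ (suc i) + fromℕ (suc M) ≈ fromℕ (suc (suc i)) + fromℕ M
  shift-suc i M = solve 3 (λ o a b → a :+ (o :+ b) := (o :+ a) :+ b) refl 1# (fromℕ (suc i)) (fromℕ M)

  convolution-suc : ∀ x z i M → (fromℕ (suc i) + fromℕ (suc M)) * convolution x z (suc i) (suc M) ≈
                                z * convolution x z i (suc M) + x * convolution x z (suc i) M
  convolution-suc x z i zero = begin
    (fromℕ (suc i) + fromℕ 1) * (z ^ suc i /! * x ^ 1 /! + z ^ suc (suc i) /! * 1#)
      ≈⟨ distribˡ _ _ _ ⟩
    (fromℕ (suc i) + fromℕ 1) * (z ^ suc i /! * x ^ 1 /!) + (fromℕ (suc i) + fromℕ 1) * (z ^ suc (suc i) /! * 1#)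
      ≈⟨ +-cong (term-suc x z i 0) (*-cong (trans (shift-suc i 0) (+-identityʳ _)) (*-identityʳ _)) ⟩
    (z * (z ^ i /! * x ^ 1 /!) + x * (z ^ suc i /! * 1#)) + fromℕ (suc (suc i)) * z ^ suc (suc i) /!
      ≈⟨ +-congˡ (suc-^/! (suc i) z) ⟩
    (z * (z ^ i /! * x ^ 1 /!) + x * (z ^ suc i /! * 1#)) + z * z ^ suc i /!
      ≈⟨ +-congˡ (*-congˡ (*-identityʳ _)) ⟨
    (z * (z ^ i /! * x ^ 1 /!) + x * (z ^ suc i /! * 1#)) + z * (z ^ suc i /! * 1#)
      ≈⟨ solve 4 (λ z a b c → (z :* a :+ b) :+ z :* c := z :* (a :+ c) :+ b) refl z (z ^ i /! * x ^ 1 /!) (x * (z ^ suc i /! * 1#)) (z ^ suc i /! * 1#) ⟩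
    z * convolution x z i 1 + x * convolution x z (suc i) 0 ∎
  convolution-suc x z i (suc M) = begin
    (fromℕ (suc i) + fromℕ (suc (suc M))) * (z ^ suc i /! * x ^ suc (suc M) /! + convolution x z (suc (suc i)) (suc M))
      ≈⟨ distribˡ _ _ _ ⟩
    (fromℕ (suc i) + fromℕ (suc (suc M))) * (z ^ suc i /! * x ^ suc (suc M) /!) +
    (fromℕ (suc i) + fromℕ (suc (suc M))) * convolution x z (suc (suc i)) (suc M)
      ≈⟨ +-cong (term-suc x z i (suc M)) (trans (*-congʳ (shift-suc i (suc M))) (convolution-suc x z (suc i) M)) ⟩
    (z * (z ^ i /! * x ^ suc (suc M) /!) + x * (z ^ suc i /! * x ^ suc M /!)) +
    (z * convolution x z (suc i) (suc M) + x * convolution x z (suc (suc i)) M)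
      ≈⟨ solve 6 (λ z x a b c d → (z :* a :+ x :* b) :+ (z :* c :+ x :* d) := z :* (a :+ c) :+ x :* (b :+ d)) refl
           z x (z ^ i /! * x ^ suc (suc M) /!) (z ^ suc i /! * x ^ suc M /!) (convolution x z (suc i) (suc M)) (convolution x z (suc (suc i)) M) ⟩
    z * convolution x z i (suc (suc M)) + x * convolution x z (suc i) (suc M) ∎

  convolution-0-suc : ∀ x z M → fromℕ (suc M) * convolution x z 0 (suc M) ≈ (x + z) * convolution x z 0 M
  convolution-0-suc x z zero = begin
    fromℕ 1 * (1# * x ^ 1 /! + z ^ 1 /! * 1#)
      ≈⟨ *-congˡ (+-cong (*-identityˡ _) (*-identityʳ _)) ⟩
    fromℕ 1 * (x ^ 1 /! + z ^ 1 /!)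
      ≈⟨ trans (distribˡ _ _ _) (+-cong (suc-^/! 0 x) (suc-^/! 0 z)) ⟩
    x * 1# + z * 1#
      ≈⟨ trans (sym (distribʳ _ _ _)) (*-congˡ (sym (*-identityʳ _))) ⟩
    (x + z) * (1# * 1#) ∎
  convolution-0-suc x z (suc M) = begin
    fromℕ (suc (suc M)) * (1# * x ^ suc (suc M) /! + convolution x z 1 (suc M))
      ≈⟨ trans (distribˡ _ _ _) (+-cong (*-congˡ (*-identityˡ _)) (*-congʳ (+-congʳ (sym (+-identityʳ 1#))))) ⟩
    fromℕ (suc (suc M)) * x ^ suc (suc M) /! + (fromℕ 1 + fromℕ (suc M)) * convolution x z 1 (suc M)
      ≈⟨ +-cong (suc-^/! (suc M) x) (convolution-suc x z 0 M) ⟩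
    x * x ^ suc M /! + (z * convolution x z 0 (suc M) + x * convolution x z 1 M)
      ≈⟨ +-congʳ (*-congˡ (*-identityˡ _)) ⟨
    x * (1# * x ^ suc M /!) + (z * convolution x z 0 (suc M) + x * convolution x z 1 M)
      ≈⟨ solve 5 (λ x z a b c → x :* a :+ (z :* b :+ x :* c) := x :* (a :+ c) :+ z :* b) refl
           x z (1# * x ^ suc M /!) (convolution x z 0 (suc M)) (convolution x z 1 M) ⟩
    x * convolution x z 0 (suc M) + z * convolution x z 0 (suc M)
      ≈⟨ distribʳ _ _ _ ⟨
    (x + z) * convolution x z 0 (suc M) ∎

  convolution-0 : ∀ x z M → convolution x z 0 M ≈ (x + z) ^ M /!
  convolution-0 x z zero    = *-identityʳ 1#
  convolution-0 x z (suc M) = *-cancelˡ-≈ (suc M)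
    (trans (convolution-0-suc x z M) (trans (*-congˡ (convolution-0 x z M)) (sym (suc-^/! M (x + z)))))

  -- ∑ over q ≤ N of z^(i+q)/(i+q)! · exp (N − q) x (μ shifted by q)
  taylor : Carrier → Carrier → ℕ → ℕ → (ℕ → Carrier) → Carrier
  taylor x z i zero    μ = z ^ i /! * μ 0
  taylor x z i (suc N) μ = z ^ i /! * exp (suc N) x μ + taylor x z (suc i) N (μ ∘ suc)

  taylor-suc : ∀ x z i N μ → taylor x z i (suc N) μ ≈ taylor x z i N μ + convolution x z i (suc N) * μ (suc N)
  taylor-suc x z i zero μ = trans
    (solve 5 (λ a b c d e → a :* (c :+ d :* e) :+ b :* e := a :* c :+ (a :* d :+ b) :* e) refl
      (z ^ i /!) (z ^ suc i /!) (μ 0) (x ^ 1 /!) (μ 1))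
    (+-congˡ (*-congʳ (+-congˡ (sym (*-identityʳ _)))))
  taylor-suc x z i (suc N) μ = begin
    h * (exp (suc N) x μ + p * m) + taylor x z (suc i) (suc N) (μ ∘ suc)
      ≈⟨ +-congˡ (taylor-suc x z (suc i) N (μ ∘ suc)) ⟩
    h * (exp (suc N) x μ + p * m) + (taylor x z (suc i) N (μ ∘ suc) + convolution x z (suc i) (suc N) * m)
      ≈⟨ solve 6 (λ h e p m t k → h :* (e :+ p :* m) :+ (t :+ k :* m) := (h :* e :+ t) :+ (h :* p :+ k) :* m) refl
           h (exp (suc N) x μ) p m (taylor x z (suc i) N (μ ∘ suc)) (convolution x z (suc i) (suc N)) ⟩
    taylor x z i (suc N) μ + convolution x z i (suc (suc N)) * m ∎
    where
    h = z ^ i /!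
    p = x ^ suc (suc N) /!
    m = μ (suc (suc N))

  exp-+ : ∀ N x z μ → exp N (x + z) μ ≈ taylor x z 0 N μ
  exp-+ zero    x z μ = sym (*-identityˡ _)
  exp-+ (suc N) x z μ = trans (+-cong (exp-+ N x z μ) (*-congʳ (sym (convolution-0 x z (suc N))))) (sym (taylor-suc x z 0 N μ))

  exp-cong₁ : ∀ N μ {x x′} → x ≈ x′ → exp N x μ ≈ exp N x′ μ
  exp-cong₁ zero    μ x≈x′ = refl
  exp-cong₁ (suc N) μ x≈x′ = +-cong (exp-cong₁ N μ x≈x′) (*-congʳ (^/!-cong (suc N) x≈x′))
    where
    ^/!-cong : ∀ j {x x′} → x ≈ x′ → x ^ j /! ≈ x′ ^ j /!
    ^/!-cong zero    x≈x′ = refl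
    ^/!-cong (suc j) x≈x′ = *-cong (*-congʳ x≈x′) (^/!-cong j x≈x′)

  exp-zero : ∀ N {x} μ → x ≈ 0# → exp N x μ ≈ μ 0
  exp-zero zero    μ x≈0 = refl
  exp-zero (suc N) μ x≈0 = trans (+-cong (exp-zero N μ x≈0) (trans (*-congʳ (trans (*-congʳ (trans (*-congʳ x≈0) (zeroˡ _))) (zeroˡ _))) (zeroˡ _))) (+-identityʳ _)

module CompletelyMonotone {c ℓ} (ℝ : RealNumbers c ℓ) where
  open RealNumbers ℝ hiding (zero)
  open Density ℝ using (fromℕ)
  open OrderedField ℝ
  open IntegerSolver ℝ
  open Exponential ℝ
  open import Algebra.Properties.Semiring.Sum semiring using (sum)
  open import Relation.Binary.Reasoning.Setoid setoid

  -- On moments μ j = ∫ t^j dμ this is multiplication of the measure by 1 − y t.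
  Δ : Carrier → (ℕ → Carrier) → ℕ → Carrier
  Δ y μ j = μ j - y * μ (suc j)

  Δ* : ∀ {n} → Vector Carrier n → (ℕ → Carrier) → ℕ → Carrier
  Δ* {zero}  y μ = μ
  Δ* {suc n} y μ = Δ (head y) (Δ* (tail y) μ)

  Unit : Carrier → Set ℓ
  Unit y = 0# ≤ y × y ≤ 1#

  CompletelyMonotone : (ℕ → Carrier) → Set (c ⊔ ℓ)
  CompletelyMonotone μ = ∀ {n} (y : Vector Carrier n) → (∀ i → Unit (y i)) → ∀ j → 0# ≤ Δ* y μ j

  Δ-cong : ∀ {y y′ μ ν} → y ≈ y′ → (∀ j → μ j ≈ ν j) → ∀ j → Δ y μ j ≈ Δ y′ ν j
  Δ-cong y≈ μ≈ν j = +-cong (μ≈ν j) (-‿cong (*-cong y≈ (μ≈ν (suc j))))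

  Δ-comm : ∀ x y μ j → Δ x (Δ y μ) j ≈ Δ y (Δ x μ) j
  Δ-comm x y μ j = solve 5 (λ x y a b c → (a :- y :* b) :- x :* (b :- y :* c) := (a :- x :* b) :- y :* (b :- x :* c)) refl
    x y (μ j) (μ (suc j)) (μ (suc (suc j)))

  Δ*-Δ : ∀ {n} (y : Vector Carrier n) x μ j → Δ* y (Δ x μ) j ≈ Δ x (Δ* y μ) j
  Δ*-Δ {zero}  y x μ j = refl
  Δ*-Δ {suc n} y x μ j = trans (Δ-cong refl (Δ*-Δ (tail y) x μ) j) (Δ-comm (head y) x (Δ* (tail y) μ) j)

  Δ*-shift : ∀ {n} (y : Vector Carrier n) μ j → Δ* y (μ ∘ suc) j ≈ Δ* y μ (suc j)
  Δ*-shift {zero}  y μ j = refl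
  Δ*-shift {suc n} y μ j = Δ-cong refl (Δ*-shift (tail y) μ) j

  Δ-completelyMonotone : ∀ {y μ} → Unit y → CompletelyMonotone μ → CompletelyMonotone (Δ y μ)
  Δ-completelyMonotone {y} {μ} 0≤y≤1 cm ys 0≤ys≤1 j = ≤-respʳ-≈ (sym (Δ*-Δ ys y μ j))
    (cm (λ { zero → y ; (suc i) → ys i }) (λ { zero → 0≤y≤1 ; (suc i) → 0≤ys≤1 i }) j)

  shift-completelyMonotone : ∀ {μ} → CompletelyMonotone μ → CompletelyMonotone (μ ∘ suc)
  shift-completelyMonotone {μ} cm y 0≤y≤1 j = ≤-respʳ-≈ (sym (Δ*-shift y μ j)) (cm y 0≤y≤1 (suc j))

  completelyMonotone⇒nonNegative : ∀ {μ} → CompletelyMonotone μ → ∀ j → 0# ≤ μ j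
  completelyMonotone⇒nonNegative cm = cm {0} (λ ()) (λ ())

  Δ*-≤-Δ : ∀ {n} (y : Vector Carrier n) → (∀ i → Unit (y i)) → ∀ {μ} → CompletelyMonotone μ → ∀ i j → Δ* y μ j ≤ Δ (y i) μ j
  Δ*-≤ : ∀ {n} (y : Vector Carrier n) → (∀ i → Unit (y i)) → ∀ {μ} → CompletelyMonotone μ → ∀ j → Δ* y μ j ≤ μ j
  Δ*-≤ {zero}  y 0≤y≤1 cm j = ≤-refl
  Δ*-≤ {suc n} y 0≤y≤1 cm j = ≤-trans
    (x-y≤x (*-nonNegative (proj₁ (0≤y≤1 zero)) (cm (tail y) (0≤y≤1 ∘ suc) (suc j))))
    (Δ*-≤ (tail y) (0≤y≤1 ∘ suc) cm j)
  Δ*-≤-Δ {suc n} y 0≤y≤1 {μ} cm zero j = ≤-respˡ-≈ (Δ*-Δ (tail y) (y zero) μ j)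
    (Δ*-≤ (tail y) (0≤y≤1 ∘ suc) (Δ-completelyMonotone (0≤y≤1 zero) cm) j)
  Δ*-≤-Δ {suc n} y 0≤y≤1 cm (suc i) j = ≤-trans
    (x-y≤x (*-nonNegative (proj₁ (0≤y≤1 zero)) (cm (tail y) (0≤y≤1 ∘ suc) (suc j))))
    (Δ*-≤-Δ (tail y) (0≤y≤1 ∘ suc) cm i j)

  double : ℕ → ℕ
  double zero    = zero
  double (suc p) = suc (suc (double p))

  1/1+-unit : ∀ n → Unit (1/1+ n)
  1/1+-unit n = inverse-nonNegative (suc n) , *-cancelˡ-≤ (suc n)
    (≤-respˡ-≈ (sym (inverseʳ (suc n))) (≤-respʳ-≈ (sym (*-identityʳ _)) (x≤x+y (fromℕ-nonNegative n))))

  *-unit : ∀ {x y} → Unit x → Unit y → Unit (x * y)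
  *-unit (0≤x , x≤1) (0≤y , y≤1) = *-nonNegative 0≤x 0≤y ,
    ≤-trans (≤-respʳ-≈ (*-identityʳ _) (*-monoˡ-≤ 0≤x y≤1)) x≤1

  even-^/!-nonNegative : ∀ x p → 0# ≤ x ^ double p /!
  even-^/!-nonNegative x zero    = 0≤1
  even-^/!-nonNegative x (suc p) = ≤-respʳ-≈
    (solve 4 (λ x i j h → x :* x :* (i :* j) :* h := x :* i :* (x :* j :* h)) refl x (1/1+ (suc (double p))) (1/1+ (double p)) (x ^ double p /!))
    (*-nonNegative (*-nonNegative (0≤x² x) (*-nonNegative (proj₁ (1/1+-unit (suc (double p)))) (proj₁ (1/1+-unit (double p)))))
      (even-^/!-nonNegative x p))

  exp-Δ : ∀ N x y μ → exp N x (Δ y μ) ≈ exp N x μ - y * exp N x (μ ∘ suc)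
  exp-Δ N x y μ = trans
    (exp-linear N x (- y) (λ j → solve 3 (λ a y b → a :- y :* b := a :+ (:- y) :* b) refl (μ j) y (μ (suc j))))
    (solve 3 (λ a y b → a :+ (:- y) :* b := a :- y :* b) refl (exp N x μ) y (exp N x (μ ∘ suc)))

  EvenExpNonNegative : Carrier → Set (c ⊔ ℓ)
  EvenExpNonNegative x = ∀ p {μ} → CompletelyMonotone μ → 0# ≤ exp (double p) x μ

  -- Of the Taylor expansion in −y the terms i = 2q and i + 1 combine to a multiple of 1 − (y/(i+1)) t, which is again an
  -- admissible factor, once the odd partial sum is completed by its next term, which is nonnegative.
  pair-≥ : ∀ {x y} → Unit y → ∀ q p {μ} → CompletelyMonotone μ →
    (- y) ^ double q /! * exp (double (suc p)) x (Δ (y * 1/1+ (double q)) μ) ≤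
    (- y) ^ double q /! * exp (double (suc p)) x μ + (- y) ^ suc (double q) /! * exp (suc (double p)) x (μ ∘ suc)
  pair-≥ {x} {y} 0≤y≤1 q p {μ} cm = 0≤-⇒≤ (≤-respʳ-≈ eq
    (*-nonNegative (*-nonNegative 0≤h (proj₁ (*-unit 0≤y≤1 (1/1+-unit (double q)))))
      (*-nonNegative (even-^/!-nonNegative x (suc p)) (completelyMonotone⇒nonNegative cm _))))
    where
    h = (- y) ^ double q /!
    0≤h = even-^/!-nonNegative (- y) q
    i = 1/1+ (double q)
    e = exp (double (suc p)) x μ
    o = exp (suc (double p)) x (μ ∘ suc)
    t = x ^ double (suc p) /!
    m = μ (suc (double (suc p)))
    eq : h * (y * i) * (t * m) ≈ (h * e + - y * i * h * o) - h * exp (double (suc p)) x (Δ (y * i) μ)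
    eq = trans (solve 7 (λ h y i t m e o → h :* (y :* i) :* (t :* m) :=
                   (h :* e :+ :- y :* i :* h :* o) :- h :* (e :- y :* i :* (o :+ t :* m))) refl h y i t m e o)
               (+-congˡ (-‿cong (*-congˡ (sym (exp-Δ (double (suc p)) x (y * i) μ)))))

  taylor-nonNegative : ∀ {x y} → EvenExpNonNegative x → Unit y → ∀ q p {μ} → CompletelyMonotone μ →
    0# ≤ taylor x (- y) (double q) (double p) μ
  taylor-nonNegative x-nn 0≤y≤1 q zero    cm = *-nonNegative (even-^/!-nonNegative _ q) (completelyMonotone⇒nonNegative cm 0)
  taylor-nonNegative {y = y} x-nn 0≤y≤1 q (suc p) cm = ≤-respʳ-≈ (+-assoc _ _ _) (+-nonNegative
    (≤-trans (*-nonNegative (even-^/!-nonNegative (- y) q) (x-nn (suc p) (Δ-completelyMonotone (*-unit 0≤y≤1 (1/1+-unit (double q))) cm)))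
             (pair-≥ 0≤y≤1 q p cm))
    (taylor-nonNegative x-nn 0≤y≤1 (suc q) p (shift-completelyMonotone (shift-completelyMonotone cm))))

  exp-Δ-≤ : ∀ {x y} → EvenExpNonNegative x → Unit y → ∀ p {μ} → CompletelyMonotone μ →
    exp (double p) x (Δ y μ) ≤ exp (double p) (x - y) μ
  exp-Δ-≤ {x} {y} x-nn 0≤y≤1 zero    {μ} cm =
    x-y≤x (*-nonNegative (proj₁ 0≤y≤1) (completelyMonotone⇒nonNegative cm 1))
  exp-Δ-≤ {x} {y} x-nn 0≤y≤1 (suc p) {μ} cm = ≤-respˡ-≈ (trans (*-identityˡ _) (exp-cong (double (suc p)) (Δ-cong 1/1 (λ _ → refl))))
    (≤-respʳ-≈ (trans (+-assoc _ _ _) (sym (exp-+ (double (suc p)) x (- y) μ)))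
      (≤-trans (pair-≥ 0≤y≤1 0 p cm)
        (x≤x+y (taylor-nonNegative x-nn 0≤y≤1 1 p (shift-completelyMonotone (shift-completelyMonotone cm))))))
    where
    1/1 : y * 1/1+ 0 ≈ y
    1/1 = trans (*-congˡ (trans (sym (*-identityˡ _)) (trans (*-congʳ (sym (+-identityʳ 1#))) (inverseʳ 1)))) (*-identityʳ y)

  Δ*-≤-exp : ∀ {n} (y : Vector Carrier n) → (∀ i → Unit (y i)) → ∀ p {μ} → CompletelyMonotone μ →
    Δ* y μ 0 ≤ exp (double p) (- sum y) μ
  Δ*-≤-exp {zero}  y 0≤y≤1 p {μ} cm = ≤-reflexive (sym (exp-zero (double p) μ (trans (sym (+-identityˡ _)) (-‿inverseʳ 0#))))
  Δ*-≤-exp {suc n} y 0≤y≤1 p {μ} cm = ≤-respˡ-≈ (Δ*-Δ (tail y) (head y) μ 0)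
    (≤-trans (Δ*-≤-exp (tail y) (0≤y≤1 ∘ suc) p (Δ-completelyMonotone (0≤y≤1 zero) cm))
      (≤-respʳ-≈ (exp-cong₁ (double p) μ (solve 2 (λ a b → :- b :- a := :- (a :+ b)) refl (head y) (sum (tail y))))
        (exp-Δ-≤ (λ q cm′ → ≤-trans (cm′ (tail y) (0≤y≤1 ∘ suc) 0) (Δ*-≤-exp (tail y) (0≤y≤1 ∘ suc) q cm′)) (0≤y≤1 zero) p cm)))

suc-<-⇔ : ∀ {i j k l} → i ℕ.< j ⇔ k ℕ.< l → suc i ℕ.< suc j ⇔ suc k ℕ.< suc l
suc-<-⇔ e = mk⇔ (s<s ∘ Equivalence.to e ∘ s<s⁻¹) (s<s ∘ Equivalence.from e ∘ s<s⁻¹)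

0<-⇔ : ∀ {m n} → 0 ℕ.< suc m ⇔ 0 ℕ.< suc n
0<-⇔ = mk⇔ (λ _ → z<s) (λ _ → z<s)

punchIn-<-suc : ∀ {n} (j : Fin (suc n)) (k : Fin n) m → toℕ j ℕ.≤ m → toℕ (punchIn j k) ℕ.< suc m ⇔ toℕ k ℕ.< m
punchIn-<-suc zero    k       m       _         = mk⇔ s<s⁻¹ s<s
punchIn-<-suc (suc j) zero    (suc m) _         = 0<-⇔
punchIn-<-suc (suc j) (suc k) (suc m) (s≤s j≤m) = suc-<-⇔ (punchIn-<-suc j k m j≤m)

punchIn-<-≤ : ∀ {n} (j : Fin (suc n)) (k : Fin n) m → m ℕ.≤ toℕ j → toℕ (punchIn j k) ℕ.< m ⇔ toℕ k ℕ.< m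
punchIn-<-≤ j       k       zero    _         = mk⇔ (λ ()) (λ ())
punchIn-<-≤ (suc j) zero    (suc m) _         = 0<-⇔
punchIn-<-≤ (suc j) (suc k) (suc m) (s≤s m≤j) = suc-<-⇔ (punchIn-<-≤ j k m m≤j)

<-punchIn : ∀ {n} (j : Fin (suc n)) (l : Fin n) → toℕ j ℕ.< toℕ (punchIn j l) ⇔ toℕ j ℕ.< suc (toℕ l)
<-punchIn zero    l       = 0<-⇔
<-punchIn (suc j) zero    = mk⇔ (λ ()) (λ { (s≤s ()) })
<-punchIn (suc j) (suc l) = suc-<-⇔ (<-punchIn j l)

punchIn-<-punchIn : ∀ {n} (j : Fin (suc n)) (k l : Fin n) → toℕ (punchIn j k) ℕ.< toℕ (punchIn j l) ⇔ toℕ k ℕ.< toℕ l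
punchIn-<-punchIn j k l = mk⇔
  (λ p → ℕ.≰⇒> (λ l≤k → ℕ.<⇒≱ p (Fin.punchIn-mono-≤ j l k l≤k)))
  (λ p → ℕ.≰⇒> (λ q → ℕ.<⇒≱ p (Fin.punchIn-cancel-≤ j l k q)))

rising : ℕ → ℕ → ℕ
rising x zero    = 1
rising x (suc j) = x ℕ.* rising (suc x) j

rising-suc : ∀ x j → rising x (suc j) ≡ rising x j ℕ.* (x ℕ.+ j)
rising-suc x zero    = solve x
  where
  solve : ∀ x → x ℕ.* 1 ≡ 1 ℕ.* (x ℕ.+ 0)
  solve = solve-∀
rising-suc x (suc j) = ≡.trans (≡.cong (x ℕ.*_) (rising-suc (suc x) j)) (solve x j (rising (suc x) j))
  where
  solve : ∀ x j r → x ℕ.* (r ℕ.* (suc x ℕ.+ j)) ≡ x ℕ.* r ℕ.* (x ℕ.+ suc j)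
  solve = solve-∀

rising-1 : ∀ j → rising 1 j ≡ j !
rising-1 zero    = ≡.refl
rising-1 (suc j) = ≡.trans (rising-suc 1 j) (≡.trans (≡.cong (ℕ._* suc j) (rising-1 j)) (ℕ.*-comm (j !) (suc j)))

module PermutationSums {c ℓ} (ℝ : RealNumbers c ℓ) where
  open RealNumbers ℝ hiding (zero)
  open Density ℝ
  open OrderedField ℝ
  open IntegerSolver ℝ
  open Exponential ℝ
  open CompletelyMonotone ℝ
  open import Algebra.Properties.Semiring.Sum semiring using (sum; sum-cong-≋; sum-init-last; ∑-distrib-+; ∑-comm; *-distribˡ-sum)
  open import Algebra.Properties.CommutativeMonoid.Sum *-commutativeMonoid using () renaming (sum to product; sum-cong-≋ to product-cong)
  open import Relation.Binary.Reasoning.Setoid setoid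

  module _ {a} {A : Set a} where

    ∑-cong : ∀ {f g : A → Carrier} → (∀ x → f x ≈ g x) → ∀ xs → ∑[ map f xs ] ≈ ∑[ map g xs ]
    ∑-cong f≈g []       = refl
    ∑-cong f≈g (x ∷ xs) = +-cong (f≈g x) (∑-cong f≈g xs)

    ∑-* : ∀ b (f : A → Carrier) xs → ∑[ map (λ x → b * f x) xs ] ≈ b * ∑[ map f xs ]
    ∑-* b f []       = sym (zeroʳ b)
    ∑-* b f (x ∷ xs) = trans (+-congˡ (∑-* b f xs)) (sym (distribˡ b _ _))

    ∑-distrib : ∀ (f g : A → Carrier) xs → ∑[ map (λ x → f x + g x) xs ] ≈ ∑[ map f xs ] + ∑[ map g xs ]
    ∑-distrib f g []       = sym (+-identityʳ 0#)
    ∑-distrib f g (x ∷ xs) = trans (+-congˡ (∑-distrib f g xs))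
      (solve 4 (λ a b s t → (a :+ b) :+ (s :+ t) := (a :+ s) :+ (b :+ t)) refl (f x) (g x) ∑[ map f xs ] ∑[ map g xs ])

    ∑-nonNegative : ∀ {f : A → Carrier} → (∀ x → 0# ≤ f x) → ∀ xs → 0# ≤ ∑[ map f xs ]
    ∑-nonNegative 0≤f []       = ≤-refl
    ∑-nonNegative 0≤f (x ∷ xs) = +-nonNegative (0≤f x) (∑-nonNegative 0≤f xs)

  ∑-++ : ∀ xs ys → ∑[ xs List.++ ys ] ≈ ∑[ xs ] + ∑[ ys ]
  ∑-++ []       ys = sym (+-identityˡ _)
  ∑-++ (x ∷ xs) ys = trans (+-congˡ (∑-++ xs ys)) (sym (+-assoc _ _ _))

  ∑-concatMap : ∀ {a b d} {A : Set a} {B : Set b} {D : Set d} (f : D → Carrier) (h : B → A → D) (xs : List A) {m} (g : Fin m → B) →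
    ∑[ map f (concatMap (λ j → map (h j) xs) (tabulate g)) ] ≈ sum (λ i → ∑[ map (f ∘ h (g i)) xs ])
  ∑-concatMap f h xs {zero}  g = refl
  ∑-concatMap f h xs {suc m} g = begin
    ∑[ map f (map (h (g zero)) xs List.++ concatMap (λ j → map (h j) xs) (tabulate (g ∘ suc))) ]
      ≡⟨ ≡.cong ∑[_] (map-++ f (map (h (g zero)) xs) _) ⟩
    ∑[ map f (map (h (g zero)) xs) List.++ map f (concatMap (λ j → map (h j) xs) (tabulate (g ∘ suc))) ]
      ≈⟨ ∑-++ (map f (map (h (g zero)) xs)) _ ⟩
    ∑[ map f (map (h (g zero)) xs) ] + ∑[ map f (concatMap (λ j → map (h j) xs) (tabulate (g ∘ suc))) ]
      ≈⟨ +-cong (reflexive (≡.cong ∑[_] (≡.sym (map-∘ xs)))) (∑-concatMap f h xs (g ∘ suc)) ⟩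
    sum (λ i → ∑[ map (f ∘ h (g i)) xs ]) ∎

  ∑-permutations-suc : ∀ n (f : Permutation′ (suc n) → Carrier) →
    ∑[ map f (permutations (suc n)) ] ≈ sum (λ j → ∑[ map (f ∘ insert zero j) (permutations n) ])
  ∑-permutations-suc n f = ∑-concatMap f (insert zero) (permutations n) id

  select : ∀ {p} {P : Set p} → Dec P → Carrier → Carrier
  select P? a = if does P? then a else 1#

  select-⇔ : ∀ {p q} {P : Set p} {Q : Set q} → P ⇔ Q → (P? : Dec P) (Q? : Dec Q) → ∀ a → select P? a ≈ select Q? a
  select-⇔ P⇔Q P? Q? a = reflexive (≡.cong (λ b → if b then a else 1#) (does-⇔ P⇔Q P? Q?))

  select-nonNegative : ∀ {p} {P : Set p} (P? : Dec P) {a} → 0# ≤ a → 0# ≤ select P? a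
  select-nonNegative P? 0≤a with does P?
  ... | true  = 0≤a
  ... | false = 0≤1

  ∏-filter : ∀ {a p n} {A : Set a} {P : Pred A p} (P? : Decidable P) (f : A → Carrier) (g : Fin n → A) →
    ∏[ map f (filter P? (tabulate g)) ] ≈ product (λ i → select (P? (g i)) (f (g i)))
  ∏-filter {n = zero}  P? f g = refl
  ∏-filter {n = suc n} P? f g with does (P? (g zero))
  ... | true  = *-congˡ (∏-filter P? f (g ∘ suc))
  ... | false = trans (∏-filter P? f (g ∘ suc)) (sym (*-identityˡ _))

  product-nonNegative : ∀ {n} (a : Vector Carrier n) → (∀ i → 0# ≤ a i) → 0# ≤ product a
  product-nonNegative {zero}  a 0≤a = 0≤1
  product-nonNegative {suc n} a 0≤a = *-nonNegative (0≤a zero) (product-nonNegative (tail a) (0≤a ∘ suc))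

  sum-nonNegative : ∀ {n} (a : Vector Carrier n) → (∀ i → 0# ≤ a i) → 0# ≤ sum a
  sum-nonNegative {zero}  a 0≤a = ≤-refl
  sum-nonNegative {suc n} a 0≤a = +-nonNegative (0≤a zero) (sum-nonNegative (tail a) (0≤a ∘ suc))

  weight : ∀ {n} → Vector Carrier n → Permutation′ n → ℕ → Carrier
  weight a ρ m = product (λ i → select (toℕ (ρ ⟨$⟩ʳ i) ℕ.<? m) (a i))

  -- G n a m = m! (n − m)! times the m-th elementary symmetric polynomial in a, for m ≤ n.
  G : ∀ n → Vector Carrier n → ℕ → Carrier
  G n a m = ∑[ map (λ ρ → weight a ρ m) (permutations n) ]

  G-nonNegative : ∀ n {a} → (∀ i → 0# ≤ a i) → ∀ m → 0# ≤ G n a m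
  G-nonNegative n 0≤a m = ∑-nonNegative (λ ρ → product-nonNegative _ (λ i → select-nonNegative (toℕ (ρ ⟨$⟩ʳ i) ℕ.<? m) (0≤a i))) (permutations n)

  sum-threshold : ∀ {N m} (f : Vector Carrier N) A B → m ℕ.≤ N →
    (∀ j → toℕ j ℕ.< m → f j ≈ A) → (∀ j → m ℕ.≤ toℕ j → f j ≈ B) →
    sum f ≈ fromℕ m * A + fromℕ (N ℕ.∸ m) * B
  sum-threshold {zero}  f A B z≤n f≈A f≈B = sym (trans (+-cong (zeroˡ A) (zeroˡ B)) (+-identityʳ 0#))
  sum-threshold {suc N} f A B z≤n f≈A f≈B = trans
    (+-cong (f≈B zero z≤n) (sum-threshold (tail f) A B (z≤n {N}) (λ _ ()) (λ j _ → f≈B (suc j) z≤n)))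
    (trans (+-cong (sym (*-identityˡ B)) (trans (+-congʳ (zeroˡ A)) (+-identityˡ _)))
      (trans (sym (distribʳ B _ _)) (sym (trans (+-congʳ (zeroˡ A)) (+-identityˡ _)))))
  sum-threshold {suc N} {suc m} f A B (s≤s m≤N) f≈A f≈B = trans
    (+-cong (f≈A zero z<s) (sum-threshold (tail f) A B m≤N (λ j j<m → f≈A (suc j) (s<s j<m)) (λ j m≤j → f≈B (suc j) (s≤s m≤j))))
    (trans (sym (+-assoc _ _ _)) (+-congʳ (trans (+-congʳ (sym (*-identityˡ A))) (sym (distribʳ A _ _)))))

  G-insert-< : ∀ n a (j : Fin (suc n)) m → toℕ j ℕ.≤ m →
    ∑[ map (λ ρ → weight a (insert zero j ρ) (suc m)) (permutations n) ] ≈ head a * G n (tail a) m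
  G-insert-< n a j m j≤m = trans
    (∑-cong (λ ρ → *-cong (select-true (s≤s j≤m)) (product-cong (λ i → select-⇔ (punchIn-<-suc j (ρ ⟨$⟩ʳ i) m j≤m) (_ ℕ.<? _) (_ ℕ.<? _) (a (suc i))))) (permutations n))
    (∑-* (head a) (λ ρ → weight (tail a) ρ m) (permutations n))
    where
    select-true : toℕ j ℕ.< suc m → select (toℕ j ℕ.<? suc m) (head a) ≈ head a
    select-true j<m = reflexive (≡.cong (λ b → if b then head a else 1#) (dec-true (toℕ j ℕ.<? suc m) j<m))

  G-insert-≥ : ∀ n a (j : Fin (suc n)) m → m ℕ.≤ toℕ j →
    ∑[ map (λ ρ → weight a (insert zero j ρ) m) (permutations n) ] ≈ G n (tail a) m
  G-insert-≥ n a j m m≤j = ∑-cong (λ ρ → trans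
    (*-cong (reflexive (≡.cong (λ b → if b then head a else 1#) (dec-false (toℕ j ℕ.<? m) (ℕ.≤⇒≯ m≤j))))
            (product-cong (λ i → select-⇔ (punchIn-<-≤ j (ρ ⟨$⟩ʳ i) m m≤j) (_ ℕ.<? _) (_ ℕ.<? _) (a (suc i)))))
    (*-identityˡ _)) (permutations n)

  G-suc-zero : ∀ n a → G (suc n) a 0 ≈ fromℕ (suc n) * G n (tail a) 0
  G-suc-zero n a = trans (∑-permutations-suc n (λ ρ → weight a ρ 0))
    (trans (sum-threshold {m = 0} _ 0# (G n (tail a) 0) z≤n (λ _ ()) (λ j _ → G-insert-≥ n a j 0 z≤n))
           (trans (+-congʳ (zeroʳ _)) (+-identityˡ _)))

  G-suc-suc : ∀ n a m → m ℕ.≤ n →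
    G (suc n) a (suc m) ≈ fromℕ (suc m) * (head a * G n (tail a) m) + fromℕ (n ℕ.∸ m) * G n (tail a) (suc m)
  G-suc-suc n a m m≤n = trans (∑-permutations-suc n (λ ρ → weight a ρ (suc m)))
    (sum-threshold {m = suc m} _ _ _ (s≤s m≤n) (λ { j (s≤s j≤m) → G-insert-< n a j m j≤m }) (λ j m<j → G-insert-≥ n a j (suc m) m<j))

  J : ∀ n → ℕ → Vector Carrier n → Carrier
  J n j a = sum {suc n} (λ l → fromℕ (rising (suc (toℕ l)) j) * G n a (toℕ l))

  J-nonNegative : ∀ n j {a} → (∀ i → 0# ≤ a i) → 0# ≤ J n j a
  J-nonNegative n j 0≤a = sum-nonNegative {suc n} _ (λ l → *-nonNegative (fromℕ-nonNegative (rising (suc (toℕ l)) j)) (G-nonNegative n 0≤a (toℕ l)))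

  J-split : ∀ n j a → J (suc n) j a ≈ sum {suc n} (λ l →
    fromℕ (rising (suc (suc (toℕ l))) j) * (fromℕ (suc (toℕ l)) * (head a * G n (tail a) (toℕ l))) +
    fromℕ (rising (suc (toℕ l)) j) * (fromℕ (suc n ℕ.∸ toℕ l) * G n (tail a) (toℕ l)))
  J-split n j a = begin
    J (suc n) j a
      ≈⟨ sum-cong-≋ step ⟩
    sum {suc (suc n)} (λ m → t₁ m + t₂ (toℕ m))
      ≈⟨ ∑-distrib-+ t₁ (t₂ ∘ toℕ) ⟩
    (0# + sum (tail t₁)) + sum {suc (suc n)} (t₂ ∘ toℕ)
      ≈⟨ +-cong (+-identityˡ _) (sum-init-last {suc n} (t₂ ∘ toℕ)) ⟩
    sum (tail t₁) + (sum {suc n} (λ l → t₂ (toℕ (inject₁ l))) + t₂ (toℕ (Fin.fromℕ (suc n))))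
      ≈⟨ +-congˡ (+-cong (sum-cong-≋ {suc n} (λ l → reflexive (≡.cong t₂ (Fin.toℕ-inject₁ l)))) t₂-last) ⟩
    sum (tail t₁) + (sum {suc n} (t₂ ∘ toℕ) + 0#)
      ≈⟨ +-congˡ (+-identityʳ _) ⟩
    sum (tail t₁) + sum {suc n} (t₂ ∘ toℕ)
      ≈⟨ ∑-distrib-+ (tail t₁) (t₂ ∘ toℕ) ⟨
    sum {suc n} (λ l → tail t₁ l + t₂ (toℕ l)) ∎
    where
    g = G n (tail a)
    r = λ m → fromℕ (rising (suc m) j)
    t₁ : Vector Carrier (suc (suc n))
    t₁ zero    = 0#
    t₁ (suc l) = r (suc (toℕ l)) * (fromℕ (suc (toℕ l)) * (head a * g (toℕ l)))
    t₂ : ℕ → Carrier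
    t₂ m = r m * (fromℕ (suc n ℕ.∸ m) * g m)
    step : ∀ m → r (toℕ m) * G (suc n) a (toℕ m) ≈ t₁ m + t₂ (toℕ m)
    step zero    = trans (*-congˡ (G-suc-zero n a)) (sym (+-identityˡ _))
    step (suc l) = trans (*-congˡ (G-suc-suc n a (toℕ l) (ℕ.≤-pred (Fin.toℕ<n l)))) (distribˡ _ _ _)
    t₂-last : t₂ (toℕ (Fin.fromℕ (suc n))) ≈ 0#
    t₂-last = begin
      t₂ (toℕ (Fin.fromℕ (suc n)))         ≡⟨ ≡.cong t₂ (Fin.toℕ-fromℕ (suc n)) ⟩
      r (suc n) * (fromℕ (suc n ℕ.∸ suc n) * g (suc n))
        ≡⟨ ≡.cong (λ k → r (suc n) * (fromℕ k * g (suc n))) (ℕ.n∸n≡0 (suc n)) ⟩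
      r (suc n) * (0# * g (suc n))         ≈⟨ *-congˡ (zeroˡ _) ⟩
      r (suc n) * 0#                       ≈⟨ zeroʳ _ ⟩
      0#                                   ∎

  J-suc : ∀ n j (a : Vector Carrier (suc n)) →
    J (suc n) j a ≈ fromℕ (suc (suc (n ℕ.+ j))) * J n j (tail a) - (1# - head a) * J n (suc j) (tail a)
  J-suc n j a = begin
    J (suc n) j a
      ≈⟨ J-split n j a ⟩
    sum {suc n} (λ l → fromℕ (rising (suc (suc (toℕ l))) j) * (fromℕ (suc (toℕ l)) * (head a * g (toℕ l))) +
                       r (toℕ l) * (fromℕ (suc n ℕ.∸ toℕ l) * g (toℕ l)))
      ≈⟨ sum-cong-≋ {suc n} (λ l → step (toℕ l) (ℕ.<⇒≤ (Fin.toℕ<n l))) ⟩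
    sum {suc n} (λ l → s * (r (toℕ l) * g (toℕ l)) + - (1# - head a) * (r′ (toℕ l) * g (toℕ l)))
      ≈⟨ ∑-distrib-+ {suc n} (λ l → s * (r (toℕ l) * g (toℕ l))) (λ l → - (1# - head a) * (r′ (toℕ l) * g (toℕ l))) ⟩
    sum {suc n} (λ l → s * (r (toℕ l) * g (toℕ l))) + sum {suc n} (λ l → - (1# - head a) * (r′ (toℕ l) * g (toℕ l)))
      ≈⟨ +-cong (sym (*-distribˡ-sum {suc n} s (λ l → r (toℕ l) * g (toℕ l))))
                (sym (*-distribˡ-sum {suc n} (- (1# - head a)) (λ l → r′ (toℕ l) * g (toℕ l)))) ⟩
    s * J n j (tail a) + - (1# - head a) * J n (suc j) (tail a)
      ≈⟨ solve 3 (λ x y z → x :+ :- y :* z := x :- y :* z) refl (s * J n j (tail a)) (1# - head a) (J n (suc j) (tail a)) ⟩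
    s * J n j (tail a) - (1# - head a) * J n (suc j) (tail a) ∎
    where
    g = G n (tail a)
    s = fromℕ (suc (suc (n ℕ.+ j)))
    r r′ : ℕ → Carrier
    r l = fromℕ (rising (suc l) j)
    r′ l = fromℕ (rising (suc l) (suc j))

    weights : ∀ l → l ℕ.≤ suc n → s * r l ≈ r′ l + fromℕ (suc n ℕ.∸ l) * r l
    weights l l≤1+n = begin
      s * r l
        ≡⟨ ≡.cong (λ k → fromℕ k * r l) (≡.trans (≡.cong (λ k → suc (k ℕ.+ j)) (≡.sym (ℕ.m+[n∸m]≡n l≤1+n))) (rearrange l (suc n ℕ.∸ l) j)) ⟩
      fromℕ (suc l ℕ.+ j ℕ.+ (suc n ℕ.∸ l)) * r l
        ≈⟨ trans (*-congʳ (fromℕ-+ (suc l ℕ.+ j) (suc n ℕ.∸ l))) (distribʳ _ _ _) ⟩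
      fromℕ (suc l ℕ.+ j) * r l + fromℕ (suc n ℕ.∸ l) * r l
        ≈⟨ +-congʳ (trans (*-comm _ _) (sym (fromℕ-* (rising (suc l) j) (suc l ℕ.+ j)))) ⟩
      fromℕ (rising (suc l) j ℕ.* (suc l ℕ.+ j)) + fromℕ (suc n ℕ.∸ l) * r l
        ≡⟨ ≡.cong (λ k → fromℕ k + fromℕ (suc n ℕ.∸ l) * r l) (rising-suc (suc l) j) ⟨
      r′ l + fromℕ (suc n ℕ.∸ l) * r l ∎
      where
      rearrange : ∀ l m j → suc (l ℕ.+ m ℕ.+ j) ≡ suc l ℕ.+ j ℕ.+ m
      rearrange = solve-∀

    step : ∀ l → l ℕ.≤ suc n →
      fromℕ (rising (suc (suc l)) j) * (fromℕ (suc l) * (head a * g l)) + r l * (fromℕ (suc n ℕ.∸ l) * g l) ≈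
      s * (r l * g l) + - (1# - head a) * (r′ l * g l)
    step l l≤1+n = begin
      fromℕ (rising (suc (suc l)) j) * (fromℕ (suc l) * (head a * g l)) + r l * (fromℕ (suc n ℕ.∸ l) * g l)
        ≈⟨ +-congʳ (trans (solve 3 (λ p q x → p :* (q :* x) := q :* p :* x) refl (fromℕ (rising (suc (suc l)) j)) (fromℕ (suc l)) (head a * g l))
                          (*-congʳ (sym (fromℕ-* (suc l) (rising (suc (suc l)) j))))) ⟩
      r′ l * (head a * g l) + r l * (fromℕ (suc n ℕ.∸ l) * g l)
        ≈⟨ solve 5 (λ r′ a g r d → r′ :* (a :* g) :+ r :* (d :* g) :=
                     (r′ :+ d :* r) :* g :+ :- (con (+ 1) :- a) :* (r′ :* g)) refl (r′ l) (head a) (g l) (r l) (fromℕ (suc n ℕ.∸ l)) ⟩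
      (r′ l + fromℕ (suc n ℕ.∸ l) * r l) * g l + - (fromℤ (+ 1) - head a) * (r′ l * g l)
        ≈⟨ +-cong (trans (*-congʳ (sym (weights l l≤1+n))) (*-assoc _ _ _)) (*-congʳ (-‿cong (+-congʳ fromℤ-1))) ⟩
      s * (r l * g l) + - (1# - head a) * (r′ l * g l) ∎

  J-zero : ∀ j a → J 0 j a ≈ fromℕ (j !)
  J-zero j a = trans (+-identityʳ _) (trans (*-congˡ (+-identityʳ 1#)) (trans (*-identityʳ _) (reflexive (≡.cong fromℕ (rising-1 j)))))

  -- Both sides are (n+j+1)! ∫ t^j ∏ (1 − t y i) dt over [0,1]; t is the arrival time of the distinguished terminal.
  Δ*-J : ∀ {n} (y : Vector Carrier n) j → fromℕ (suc (n ℕ.+ j) !) * Δ* y 1/1+ j ≈ J n j (λ i → 1# - y i)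
  Δ*-J {zero} y j = begin
    fromℕ (suc j ℕ.* j !) * 1/1+ j            ≈⟨ *-congʳ (fromℕ-* (suc j) (j !)) ⟩
    fromℕ (suc j) * fromℕ (j !) * 1/1+ j      ≈⟨ solve 3 (λ a b c → a :* b :* c := a :* c :* b) refl (fromℕ (suc j)) (fromℕ (j !)) (1/1+ j) ⟩
    fromℕ (suc j) * 1/1+ j * fromℕ (j !)      ≈⟨ trans (*-congʳ (inverseʳ (suc j))) (*-identityˡ _) ⟩
    fromℕ (j !)                               ≈⟨ J-zero j (λ i → 1# - y i) ⟨
    J 0 j (λ i → 1# - y i)                    ∎
  Δ*-J {suc n} y j = begin
    fromℕ (suc (suc (n ℕ.+ j)) ℕ.* suc (n ℕ.+ j) !) * (D j - head y * D (suc j))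
      ≈⟨ solve 4 (λ a d y e → a :* (d :- y :* e) := a :* d :- y :* (a :* e)) refl (fromℕ (suc (suc (n ℕ.+ j)) !)) (D j) (head y) (D (suc j)) ⟩
    fromℕ (suc (suc (n ℕ.+ j)) ℕ.* suc (n ℕ.+ j) !) * D j - head y * (fromℕ (suc (suc (n ℕ.+ j)) !) * D (suc j))
      ≈⟨ +-cong (trans (*-congʳ (fromℕ-* (suc (suc (n ℕ.+ j))) (suc (n ℕ.+ j) !))) (trans (*-assoc _ _ _) (*-congˡ (Δ*-J (tail y) j))))
                (-‿cong (*-cong (sym 1-[1-y]) (trans (reflexive (≡.cong (λ k → fromℕ (suc k !) * D (suc j)) (≡.sym (ℕ.+-suc n j)))) (Δ*-J (tail y) (suc j))))) ⟩
    fromℕ (suc (suc (n ℕ.+ j))) * J n j (λ i → 1# - tail y i) - (1# - (1# - head y)) * J n (suc j) (λ i → 1# - tail y i)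
      ≈⟨ J-suc n j (λ i → 1# - y i) ⟨
    J (suc n) j (λ i → 1# - y i) ∎
    where
    D = Δ* (tail y) 1/1+
    1-[1-y] : 1# - (1# - head y) ≈ head y
    1-[1-y] = solve 2 (λ o y → o :- (o :- y) := y) refl 1# (head y)

  1/1+-completelyMonotone : CompletelyMonotone 1/1+
  1/1+-completelyMonotone {n} y 0≤y≤1 j = *-cancelˡ-≤ (suc (n ℕ.+ j) !) {{suc (n ℕ.+ j) ℕ.!≢0}}
    (≤-respˡ-≈ (sym (zeroʳ _)) (≤-respʳ-≈ (sym (Δ*-J y j)) (J-nonNegative n j (λ i → ≤⇒0≤- (proj₂ (0≤y≤1 i))))))

module DensityFormula {c ℓ} (ℝ : RealNumbers c ℓ) where
  open RealNumbers ℝ hiding (zero)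
  open Density ℝ
  open OrderedField ℝ
  open IntegerSolver ℝ
  open Exponential ℝ
  open CompletelyMonotone ℝ
  open PermutationSums ℝ
  open import Algebra.Properties.Semiring.Sum semiring using (sum; sum-cong-≋; ∑-comm)
  open import Algebra.Properties.CommutativeMonoid.Sum *-commutativeMonoid using () renaming (sum to product; sum-cong-≋ to product-cong)
  open import Relation.Binary.Reasoning.Setoid setoid

  module _ {k} (a : Vector Carrier k) where

    preceding : Permutation′ k → Fin k → Carrier
    preceding σ j = product (λ i → select ((σ ⟨$⟩ʳ i) Fin.<? (σ ⟨$⟩ʳ j)) (a i))

  ∑-term : ∀ {k} (x : Vector Carrier k) j →
    ∑[ map (λ σ → term x σ j) (permutations k) ] ≈
    F′ (x j) * ∑[ map (λ σ → preceding (λ i → 1# - F (x i)) σ j) (permutations k) ]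
  ∑-term {k} x j = trans
    (∑-cong (λ σ → *-congˡ (∏-filter (λ i → (σ ⟨$⟩ʳ i) Fin.<? (σ ⟨$⟩ʳ j)) (λ i → 1# - F (x i)) id)) (permutations k))
    (∑-* (F′ (x j)) (λ σ → preceding (λ i → 1# - F (x i)) σ j) (permutations k))

  select-irrefl : ∀ m a → select (m ℕ.<? m) a ≈ 1#
  select-irrefl m a = reflexive (≡.cong (λ b → if b then a else 1#) (dec-false (m ℕ.<? m) (ℕ.<-irrefl ≡.refl)))

  ∑-preceding-0 : ∀ n (a : Vector Carrier (suc n)) →
    ∑[ map (λ σ → preceding a σ zero) (permutations (suc n)) ] ≈ J n 0 (tail a)
  ∑-preceding-0 n a = trans (∑-permutations-suc n (λ σ → preceding a σ zero))
    (sum-cong-≋ {suc n} (λ j → trans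
      (∑-cong (λ ρ → trans
        (*-cong (select-irrefl (toℕ j) (a zero))
          (product-cong (λ i → select-⇔ (punchIn-<-≤ j (ρ ⟨$⟩ʳ i) (toℕ j) ℕ.≤-refl) (_ ℕ.<? _) (_ ℕ.<? _) (a (suc i)))))
        (*-identityˡ _)) (permutations n))
      (sym (trans (*-congʳ (+-identityʳ 1#)) (*-identityˡ _)))))

  ∑-preceding-1 : ∀ n (a : Vector Carrier (suc (suc n))) →
    ∑[ map (λ σ → preceding a σ (suc zero)) (permutations (suc (suc n))) ] ≈ J (suc n) 0 (a ∘ punchIn (suc zero))
  ∑-preceding-1 n a = begin
    ∑[ map (λ σ → preceding a σ (suc zero)) (permutations (suc (suc n))) ]
      ≈⟨ ∑-permutations-suc (suc n) (λ σ → preceding a σ (suc zero)) ⟩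
    sum {suc (suc n)} (λ j → ∑[ map (λ ρ → preceding a (insert zero j ρ) (suc zero)) (permutations (suc n)) ])
      ≈⟨ sum-cong-≋ {suc (suc n)} (λ j → trans
           (∑-permutations-suc n (λ ρ → preceding a (insert zero j ρ) (suc zero)))
           (sum-cong-≋ {suc n} (inner j))) ⟩
    sum {suc (suc n)} (λ j → sum {suc n} (λ l → h j l))
      ≈⟨ ∑-comm {suc (suc n)} {suc n} h ⟩
    sum {suc n} (λ l → sum {suc (suc n)} (λ j → h j l))
      ≈⟨ sum-cong-≋ {suc n} outer ⟩
    sum {suc n} (λ l → fromℕ 1 * (fromℕ (suc (toℕ l)) * (a zero * g (toℕ l))) + fromℕ 1 * (fromℕ (suc n ℕ.∸ toℕ l) * g (toℕ l)))
      ≈⟨ J-split n 0 (a ∘ punchIn (suc zero)) ⟨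
    J (suc n) 0 (a ∘ punchIn (suc zero)) ∎
    where
    a″ = tail (tail a)
    g = G n a″
    h : Fin (suc (suc n)) → Fin (suc n) → Carrier
    h j l = select (toℕ j ℕ.<? suc (toℕ l)) (a zero) * g (toℕ l)
    inner : ∀ j l → ∑[ map (λ π → preceding a (insert zero j (insert zero l π)) (suc zero)) (permutations n) ] ≈ h j l
    inner j l = trans
      (∑-cong (λ π → *-cong (select-⇔ (<-punchIn j l) (_ ℕ.<? _) (_ ℕ.<? _) (a zero))
        (trans (*-cong (select-irrefl (toℕ (punchIn j l)) (a (suc zero)))
          (product-cong (λ i → trans
            (select-⇔ (punchIn-<-punchIn j (punchIn l (π ⟨$⟩ʳ i)) l) (_ ℕ.<? _) (_ ℕ.<? _) (a (suc (suc i))))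
            (select-⇔ (punchIn-<-≤ l (π ⟨$⟩ʳ i) (toℕ l) ℕ.≤-refl) (_ ℕ.<? _) (_ ℕ.<? _) (a (suc (suc i)))))))
        (*-identityˡ _))) (permutations n))
      (∑-* (select (toℕ j ℕ.<? suc (toℕ l)) (a zero)) (λ π → weight a″ π (toℕ l)) (permutations n))
    outer : ∀ l → sum {suc (suc n)} (λ j → h j l) ≈
      fromℕ 1 * (fromℕ (suc (toℕ l)) * (a zero * g (toℕ l))) + fromℕ 1 * (fromℕ (suc n ℕ.∸ toℕ l) * g (toℕ l))
    outer l = trans
      (sum-threshold {suc (suc n)} {suc (toℕ l)} (λ j → h j l) (a zero * g (toℕ l)) (g (toℕ l)) (s≤s (ℕ.<⇒≤ (Fin.toℕ<n l)))
        (λ j j<l → *-congʳ (reflexive (≡.cong (λ b → if b then a zero else 1#) (dec-true (toℕ j ℕ.<? suc (toℕ l)) j<l))))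
        (λ j l≤j → trans (*-congʳ (reflexive (≡.cong (λ b → if b then a zero else 1#) (dec-false (toℕ j ℕ.<? suc (toℕ l)) (ℕ.≤⇒≯ l≤j))))) (*-identityˡ _)))
      (sym (+-cong (trans (*-congʳ (+-identityʳ 1#)) (*-identityˡ _)) (trans (*-congʳ (+-identityʳ 1#)) (*-identityˡ _))))

  capture : ∀ {n} → Vector Carrier n → Carrier
  capture x = Δ* (F ∘ x) 1/1+ 0

  J-0 : ∀ n (x : Vector Carrier n) → J n 0 (λ i → 1# - F (x i)) ≈ fromℕ (suc n !) * capture x
  J-0 n x = trans (sym (Δ*-J (F ∘ x) 0)) (*-congʳ (reflexive (≡.cong (λ k → fromℕ (suc k !)) (ℕ.+-identityʳ n))))

  density : ∀ n .(2≤k : 2 ℕ.≤ suc (suc n)) x →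
    d 2≤k x ≈ F′ (x zero) * capture (tail x) + F′ (x (suc zero)) * capture (x ∘ punchIn (suc zero))
  density n 2≤k x = begin
    1 / k! * ∑[ map (λ σ → term x σ zero + term x σ (suc zero)) (permutations (suc (suc n))) ]
      ≈⟨ *-congˡ (∑-distrib (λ σ → term x σ zero) (λ σ → term x σ (suc zero)) (permutations (suc (suc n)))) ⟩
    1 / k! * (∑[ map (λ σ → term x σ zero) (permutations (suc (suc n))) ] + ∑[ map (λ σ → term x σ (suc zero)) (permutations (suc (suc n))) ])
      ≈⟨ *-congˡ (+-cong (trans (∑-term x zero) (*-congˡ (trans (∑-preceding-0 (suc n) a) (J-0 (suc n) (tail x)))))
                         (trans (∑-term x (suc zero)) (*-congˡ (trans (∑-preceding-1 n a) (J-0 (suc n) (x ∘ punchIn (suc zero))))))) ⟩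
    1 / k! * (p * (fromℕ k! * u) + q * (fromℕ k! * v))
      ≈⟨ solve 7 (λ o i k p u q v → o :* i :* (p :* (k :* u) :+ q :* (k :* v)) := o :* (k :* i) :* (p :* u :+ q :* v)) refl
           (fromℕ 1) (fromℕ k! ⁻¹) (fromℕ k!) p u q v ⟩
    fromℕ 1 * (fromℕ k! * fromℕ k! ⁻¹) * (p * u + q * v)
      ≈⟨ *-congʳ (*-cong (+-identityʳ 1#) (inverseʳ k! {{suc (suc n) ℕ.!≢0}})) ⟩
    1# * 1# * (p * u + q * v)
      ≈⟨ trans (*-congʳ (*-identityˡ 1#)) (*-identityˡ _) ⟩
    p * u + q * v ∎
    where
    a = λ i → 1# - F (x i)
    k! = suc (suc n) !
    p = F′ (x zero)
    u = capture (tail x)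
    q = F′ (x (suc zero))
    v = capture (x ∘ punchIn (suc zero))

module Numeric {c ℓ} (ℝ : RealNumbers c ℓ) where
  open RealNumbers ℝ hiding (zero)
  open Density ℝ using (fromℕ; _/_)
  open OrderedField ℝ
  open IntegerSolver ℝ
  open Exponential ℝ
  open import Algebra.Properties.Semiring.Exp semiring using (_^_; ^-congˡ)
  open import Relation.Binary.Reasoning.Setoid setoid

  -- 2/(j+1) − κ(1−v)/(j+2) is the integral of t^j (2 − κ(1−v)t).
  moment : Carrier → ℕ → Carrier
  moment v j = fromℕ 2 * 1/1+ j - 11 / 6 * (1# - v) * 1/1+ (suc j)

  moment-cleared : ∀ v j → fromℕ (6 ℕ.* (suc j ℕ.* suc (suc j))) * moment v j ≈
                           fromℕ (12 ℕ.* suc (suc j)) - fromℕ (11 ℕ.* suc j) * (1# - v)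
  moment-cleared v j = begin
    fromℕ (6 ℕ.* (suc j ℕ.* suc (suc j))) * moment v j
      ≈⟨ *-congʳ (trans (fromℕ-* 6 (suc j ℕ.* suc (suc j))) (*-congˡ (fromℕ-* (suc j) (suc (suc j))))) ⟩
    fromℕ 6 * (fromℕ (suc j) * fromℕ (suc (suc j))) * moment v j
      ≈⟨ solve 8 (λ s a b two i κ w k →
           s :* (a :* b) :* (two :* i :- κ :* w :* k) :=
           s :* two :* b :* (a :* i) :- (s :* κ) :* a :* w :* (b :* k)) refl
           (fromℕ 6) (fromℕ (suc j)) (fromℕ (suc (suc j))) (fromℕ 2) (1/1+ j) (11 / 6) (1# - v) (1/1+ (suc j)) ⟩
    fromℕ 6 * fromℕ 2 * fromℕ (suc (suc j)) * (fromℕ (suc j) * 1/1+ j) -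
      (fromℕ 6 * (11 / 6)) * fromℕ (suc j) * (1# - v) * (fromℕ (suc (suc j)) * 1/1+ (suc j))
      ≈⟨ +-cong (*-congˡ (inverseʳ (suc j))) (-‿cong (*-cong (*-congʳ (*-congʳ (*-/ 11 6))) (inverseʳ (suc (suc j))))) ⟩
    fromℕ 6 * fromℕ 2 * fromℕ (suc (suc j)) * 1# - fromℕ 11 * fromℕ (suc j) * (1# - v) * 1#
      ≈⟨ +-cong (*-identityʳ _) (-‿cong (*-identityʳ _)) ⟩
    fromℕ 6 * fromℕ 2 * fromℕ (suc (suc j)) - fromℕ 11 * fromℕ (suc j) * (1# - v)
      ≈⟨ +-cong (trans (*-congʳ (sym (fromℕ-* 6 2))) (sym (fromℕ-* 12 (suc (suc j))))) (-‿cong (*-congʳ (sym (fromℕ-* 11 (suc j))))) ⟩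
    fromℕ (12 ℕ.* suc (suc j)) - fromℕ (11 ℕ.* suc j) * (1# - v) ∎

  power-cleared : ∀ v j → fromℕ (6 ℕ.^ j ℕ.* j !) * (- (11 / 6 * v)) ^ j /! ≈ (- (fromℕ 11 * v)) ^ j
  power-cleared v zero    = trans (*-identityʳ _) (+-identityʳ 1#)
  power-cleared v (suc j) = begin
    fromℕ (6 ℕ.^ suc j ℕ.* suc j !) * s ^ suc j /!
      ≡⟨ ≡.cong (λ n → fromℕ n * s ^ suc j /!) (ℕ.[m*n]*[o*p]≡[m*o]*[n*p] 6 (6 ℕ.^ j) (suc j) (j !)) ⟩
    fromℕ (6 ℕ.* suc j ℕ.* (6 ℕ.^ j ℕ.* j !)) * s ^ suc j /!
      ≈⟨ *-congʳ (trans (fromℕ-* (6 ℕ.* suc j) (6 ℕ.^ j ℕ.* j !)) (*-congʳ (fromℕ-* 6 (suc j)))) ⟩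
    fromℕ 6 * fromℕ (suc j) * fromℕ (6 ℕ.^ j ℕ.* j !) * s ^ suc j /!
      ≈⟨ solve 4 (λ a b c d → a :* b :* c :* d := a :* c :* (b :* d)) refl
           (fromℕ 6) (fromℕ (suc j)) (fromℕ (6 ℕ.^ j ℕ.* j !)) (s ^ suc j /!) ⟩
    fromℕ 6 * fromℕ (6 ℕ.^ j ℕ.* j !) * (fromℕ (suc j) * s ^ suc j /!)
      ≈⟨ *-congˡ (suc-^/! j s) ⟩
    fromℕ 6 * fromℕ (6 ℕ.^ j ℕ.* j !) * (s * s ^ j /!)
      ≈⟨ solve 5 (λ a c k v d → a :* c :* (:- (k :* v) :* d) := :- (a :* k :* v) :* (c :* d)) refl
           (fromℕ 6) (fromℕ (6 ℕ.^ j ℕ.* j !)) (11 / 6) v (s ^ j /!) ⟩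
    - (fromℕ 6 * (11 / 6) * v) * (fromℕ (6 ℕ.^ j ℕ.* j !) * s ^ j /!)
      ≈⟨ *-cong (-‿cong (*-congʳ (*-/ 11 6))) (power-cleared v j) ⟩
    (- (fromℕ 11 * v)) ^ suc j ∎
    where s = - (11 / 6 * v)

  clearing : ℕ → ℕ
  clearing j = 6 ℕ.^ j ℕ.* j ! ℕ.* (6 ℕ.* (suc j ℕ.* suc (suc j)))

  term-cleared : ∀ v j L M → L ℕ.* 11 ≡ 6 ℕ.* (M ℕ.* clearing j) →
    fromℕ L * (11 / 6 * ((- (11 / 6 * v)) ^ j /! * moment v j)) ≈
    fromℕ M * ((- (fromℕ 11 * v)) ^ j * (fromℕ (12 ℕ.* suc (suc j)) - fromℕ (11 ℕ.* suc j) * (1# - v)))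
  term-cleared v j L M eq = *-cancelˡ-≈ 6 (begin
    fromℕ 6 * (fromℕ L * (11 / 6 * (p * m)))
      ≈⟨ solve 5 (λ s l k p m → s :* (l :* (k :* (p :* m))) := l :* (s :* k) :* (p :* m)) refl (fromℕ 6) (fromℕ L) (11 / 6) p m ⟩
    fromℕ L * (fromℕ 6 * (11 / 6)) * (p * m)
      ≈⟨ *-congʳ (*-congˡ (*-/ 11 6)) ⟩
    fromℕ L * fromℕ 11 * (p * m)
      ≈⟨ *-congʳ (fromℕ-* L 11) ⟨
    fromℕ (L ℕ.* 11) * (p * m)
      ≡⟨ ≡.cong (λ n → fromℕ n * (p * m)) eq ⟩
    fromℕ (6 ℕ.* (M ℕ.* clearing j)) * (p * m)
      ≈⟨ *-congʳ (trans (fromℕ-* 6 (M ℕ.* clearing j)) (*-congˡ (trans (fromℕ-* M (clearing j)) (*-congˡ (fromℕ-* (6 ℕ.^ j ℕ.* j !) _))))) ⟩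
    fromℕ 6 * (fromℕ M * (fromℕ (6 ℕ.^ j ℕ.* j !) * fromℕ (6 ℕ.* (suc j ℕ.* suc (suc j))))) * (p * m)
      ≈⟨ solve 6 (λ s M a b p m → s :* (M :* (a :* b)) :* (p :* m) := s :* (M :* ((a :* p) :* (b :* m)))) refl
           (fromℕ 6) (fromℕ M) (fromℕ (6 ℕ.^ j ℕ.* j !)) (fromℕ (6 ℕ.* (suc j ℕ.* suc (suc j)))) p m ⟩
    fromℕ 6 * (fromℕ M * ((fromℕ (6 ℕ.^ j ℕ.* j !) * p) * (fromℕ (6 ℕ.* (suc j ℕ.* suc (suc j))) * m)))
      ≈⟨ *-congˡ (*-congˡ (*-cong (power-cleared v j) (moment-cleared v j))) ⟩
    fromℕ 6 * (fromℕ M * ((- (fromℕ 11 * v)) ^ j * (fromℕ (12 ℕ.* suc (suc j)) - fromℕ (11 ℕ.* suc j) * (1# - v)))) ∎)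
    where
    p = (- (11 / 6 * v)) ^ j /!
    m = moment v j

  -- A common multiple of 10⁶, the 6 · clearing j for j ≤ 6 and the denominators of the certificate.
  L : ℕ
  L = 45406543096285426401166130688000000

  clearedTerm : ℕ → Carrier → ℕ → Carrier
  clearedTerm M v j = fromℤ (+ M) * ((- (fromℤ (+ 11) * v)) ^ j * (fromℤ (+ (12 ℕ.* suc (suc j))) - fromℤ (+ (11 ℕ.* suc j)) * (fromℤ (+ 1) - v)))

  term-cleared-ℤ : ∀ v j M → L ℕ.* 11 ≡ 6 ℕ.* (M ℕ.* clearing j) →
    fromℕ L * (11 / 6 * ((- (11 / 6 * v)) ^ j /! * moment v j)) ≈ clearedTerm M v j
  term-cleared-ℤ v j M eq = trans (term-cleared v j L M eq)
    (*-cong (sym (fromℤ-pos M)) (*-cong (^-congˡ j (-‿cong (*-congʳ (sym (fromℤ-pos 11)))))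
       (+-cong (sym (fromℤ-pos _)) (-‿cong (*-cong (sym (fromℤ-pos _)) (+-congʳ (sym fromℤ-1)))))))

  exp-cleared : ∀ v → fromℕ L * (11 / 6 * exp 6 (- (11 / 6 * v)) (moment v)) ≈
      clearedTerm 6937110750821384589067047744000000 v 0
    + clearedTerm 385395041712299143837058208000000 v 1
    + clearedTerm 16058126738012464326544092000000 v 2
    + clearedTerm 535270891267082144218136400000 v 3
    + clearedTerm 14868635868530059561614900000 v 4
    + clearedTerm 354015139726906180038450000 v 5
    + clearedTerm 7375315410977212084134375 v 6
  exp-cleared v =
    add (add (add (add (add (add
      (trans (*-congˡ (*-congˡ (sym (*-identityˡ _)))) (term-cleared-ℤ v 0 _ ≡.refl))
      (term-cleared-ℤ v 1 _ ≡.refl)) (term-cleared-ℤ v 2 _ ≡.refl)) (term-cleared-ℤ v 3 _ ≡.refl))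
      (term-cleared-ℤ v 4 _ ≡.refl)) (term-cleared-ℤ v 5 _ ≡.refl)) (term-cleared-ℤ v 6 _ ≡.refl)
    where
    add : ∀ {a b x y z} → a * (b * x) ≈ y → ∀ {x′} → a * (b * x′) ≈ z → a * (b * (x + x′)) ≈ y + z
    add e e′ = trans (*-congˡ (distribˡ _ _ _)) (trans (distribˡ _ _ _) (+-cong e e′))

  -- The difference of the two sides nearly has a double root at 151/939 ≈ 0.1608.  Division by (939 v − 151)² leaves a
  -- quotient with positive Bernstein coefficients and a remainder with positive coefficients.
  rootFactor : Carrier → Carrier
  rootFactor v = fromℤ (+ 939) * v - fromℤ (+ 151)

  bernstein : Carrier → ℕ → ℕ → ℕ → Carrier
  bernstein v b i j = fromℤ (+ b) * (v ^ i * (fromℤ (+ 1) - v) ^ j)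

  certificate : ∀ v →
    fromℤ (+ 91453136824056092172883099154178048) -
      (  clearedTerm 6937110750821384589067047744000000 v 0
       + clearedTerm 385395041712299143837058208000000 v 1
       + clearedTerm 16058126738012464326544092000000 v 2
       + clearedTerm 535270891267082144218136400000 v 3
       + clearedTerm 14868635868530059561614900000 v 4
       + clearedTerm 354015139726906180038450000 v 5
       + clearedTerm 7375315410977212084134375 v 6)
    ≈ rootFactor v * rootFactor v *
      (  bernstein v 55729506442124731042260328125 0 5
       + bernstein v 228038135267648163439726043750 1 4
       + bernstein v 382510314197347890197310321875 2 3
       + bernstein v 325375463188848915049026187500 3 2
       + bernstein v 140344204945990335262816971875 4 1
       + bernstein v 24029399266242252895363793750 5 0)
    + (fromℤ (+ 8586991206522516900740599923) + fromℤ (+ 225002200468838555233361378125) * v)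
  certificate = solve 1 (λ v →
    con (+ 91453136824056092172883099154178048) :-
      (  term 6937110750821384589067047744000000 v 0
      :+ term 385395041712299143837058208000000 v 1
      :+ term 16058126738012464326544092000000 v 2
      :+ term 535270891267082144218136400000 v 3
      :+ term 14868635868530059561614900000 v 4
      :+ term 354015139726906180038450000 v 5
      :+ term 7375315410977212084134375 v 6)
    := sq v :* sq v :*
      (  bern v 55729506442124731042260328125 0 5
      :+ bern v 228038135267648163439726043750 1 4
      :+ bern v 382510314197347890197310321875 2 3
      :+ bern v 325375463188848915049026187500 3 2
      :+ bern v 140344204945990335262816971875 4 1
      :+ bern v 24029399266242252895363793750 5 0)
    :+ (con (+ 8586991206522516900740599923) :+ con (+ 225002200468838555233361378125) :* v)) refl
    where
    term : ℕ → Polynomial 1 → ℕ → Polynomial 1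
    term M v j = con (+ M) :* ((:- (con (+ 11) :* v)) :^ j :* (con (+ (12 ℕ.* suc (suc j))) :- con (+ (11 ℕ.* suc j)) :* (con (+ 1) :- v)))
    sq : Polynomial 1 → Polynomial 1
    sq v = con (+ 939) :* v :- con (+ 151)
    bern : Polynomial 1 → ℕ → ℕ → ℕ → Polynomial 1
    bern v b i j = con (+ b) :* (v :^ i :* (con (+ 1) :- v) :^ j)

  ^-nonNegative : ∀ {x} → 0# ≤ x → ∀ n → 0# ≤ x ^ n
  ^-nonNegative 0≤x zero    = 0≤1
  ^-nonNegative 0≤x (suc n) = *-nonNegative 0≤x (^-nonNegative 0≤x n)

  fromℤ-nonNegative : ∀ n → 0# ≤ fromℤ (+ n)
  fromℤ-nonNegative n = ≤-respʳ-≈ (sym (fromℤ-pos n)) (fromℕ-nonNegative n)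

  exp-moment-bound : ∀ v → 0# ≤ v → v ≤ 1# → 11 / 6 * exp 6 (- (11 / 6 * v)) (moment v) ≤ 2014096 / 1000000
  exp-moment-bound v 0≤v v≤1 = *-cancelˡ-≤ L (≤-respˡ-≈ (sym (exp-cleared v)) (≤-respʳ-≈ cleared (0≤-⇒≤ (≤-respʳ-≈ (sym (certificate v))
    (+-nonNegative
      (*-nonNegative (0≤x² (rootFactor v))
        (+-nonNegative (+-nonNegative (+-nonNegative (+-nonNegative (+-nonNegative
          (0≤bernstein 55729506442124731042260328125 0 5) (0≤bernstein 228038135267648163439726043750 1 4))
          (0≤bernstein 382510314197347890197310321875 2 3)) (0≤bernstein 325375463188848915049026187500 3 2))
          (0≤bernstein 140344204945990335262816971875 4 1)) (0≤bernstein 24029399266242252895363793750 5 0)))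
      (+-nonNegative (fromℤ-nonNegative _) (*-nonNegative (fromℤ-nonNegative _) 0≤v)))))))
    where
    0≤bernstein : ∀ b i j → 0# ≤ bernstein v b i j
    0≤bernstein b i j = *-nonNegative (fromℤ-nonNegative b) (*-nonNegative (^-nonNegative 0≤v i)
      (^-nonNegative (≤-respʳ-≈ (+-congʳ (sym fromℤ-1)) (≤⇒0≤- v≤1)) j))

    cleared : fromℤ (+ 91453136824056092172883099154178048) ≈ fromℕ L * (2014096 / 1000000)
    cleared = begin
      fromℤ (+ 91453136824056092172883099154178048)
        ≈⟨ fromℤ-pos 91453136824056092172883099154178048 ⟩
      fromℕ (45406543096285426401166130688 ℕ.* 2014096)
        ≈⟨ fromℕ-* 45406543096285426401166130688 2014096 ⟩
      fromℕ 45406543096285426401166130688 * fromℕ 2014096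
        ≈⟨ *-congˡ (*-/ 2014096 1000000) ⟨
      fromℕ 45406543096285426401166130688 * (fromℕ 1000000 * (2014096 / 1000000))
        ≈⟨ *-assoc _ _ _ ⟨
      fromℕ 45406543096285426401166130688 * fromℕ 1000000 * (2014096 / 1000000)
        ≈⟨ *-congʳ (fromℕ-* 45406543096285426401166130688 1000000) ⟨
      fromℕ L * (2014096 / 1000000) ∎

module Bounds {c ℓ} (ℝ : RealNumbers c ℓ) where
  open RealNumbers ℝ hiding (zero)
  open Density ℝ
  open OrderedField ℝ
  open IntegerSolver ℝ
  open Exponential ℝ
  open CompletelyMonotone ℝ
  open PermutationSums ℝ
  open DensityFormula ℝ
  open Numeric ℝ
  open import Algebra.Construct.NaturalChoice.Min totalOrder using (x≤y⇒x⊓y≈x; x≤y⇒y⊓x≈x)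
  open import Algebra.Properties.Semiring.Sum semiring using (sum; sum-cong-≋; *-distribˡ-sum)
  open import Relation.Binary.Reasoning.Setoid setoid

  fromℕ-mono-≤ : ∀ {m n} → m ℕ.≤ n → fromℕ m ≤ fromℕ n
  fromℕ-mono-≤ {n = n} z≤n = fromℕ-nonNegative n
  fromℕ-mono-≤ (s≤s m≤n)   = +-monoʳ-≤ 1# (fromℕ-mono-≤ m≤n)

  /-mono-≤ : ∀ m n p q .{{_ : ℕ.NonZero n}} .{{_ : ℕ.NonZero q}} → m ℕ.* q ℕ.≤ p ℕ.* n → m / n ≤ p / q
  /-mono-≤ m n p q mq≤pn = *-cancelˡ-≤ n (*-cancelˡ-≤ q (≤-respˡ-≈ (sym left) (≤-respʳ-≈ (sym right) (fromℕ-mono-≤ mq≤pn))))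
    where
    left : fromℕ q * (fromℕ n * (m / n)) ≈ fromℕ (m ℕ.* q)
    left = trans (*-congˡ (*-/ m n)) (trans (*-comm _ _) (sym (fromℕ-* m q)))
    right : fromℕ q * (fromℕ n * (p / q)) ≈ fromℕ (p ℕ.* n)
    right = trans (solve 3 (λ q n x → q :* (n :* x) := q :* x :* n) refl (fromℕ q) (fromℕ n) (p / q))
                  (trans (*-congʳ (*-/ p q)) (sym (fromℕ-* p n)))

  /-nonNegative : ∀ m n .{{_ : ℕ.NonZero n}} → 0# ≤ m / n
  /-nonNegative m n = *-nonNegative (fromℕ-nonNegative m) (inverse-nonNegative n)

  11/6*6/11 : 11 / 6 * (6 / 11) ≈ 1#
  11/6*6/11 = trans (solve 4 (λ a i b j → a :* i :* (b :* j) := b :* i :* (a :* j)) refl (fromℕ 11) (fromℕ 6 ⁻¹) (fromℕ 6) (fromℕ 11 ⁻¹))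
                    (trans (*-cong (inverseʳ 6) (inverseʳ 11)) (*-identityˡ 1#))

  F-small : ∀ {z} → z ≤ 6 / 11 → F z ≈ 11 / 6 * z
  F-small z≤ = x≤y⇒x⊓y≈x (≤-respʳ-≈ 11/6*6/11 (*-monoˡ-≤ (/-nonNegative 11 6) z≤))

  F-large : ∀ {z} → ¬ z ≤ 6 / 11 → F z ≈ 1#
  F-large {z} z≰ with total z (6 / 11)
  ... | inj₁ z≤ = contradiction z≤ z≰
  ... | inj₂ ≤z = x≤y⇒y⊓x≈x (≤-respˡ-≈ 11/6*6/11 (*-monoˡ-≤ (/-nonNegative 11 6) ≤z))

  F-unit : ∀ {z} → 0# ≤ z → Unit (F z)
  F-unit {z} 0≤z with z ≤? 6 / 11
  ... | yes z≤ = ≤-respʳ-≈ (sym (F-small z≤)) (*-nonNegative (/-nonNegative 11 6) 0≤z) ,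
                 ≤-respˡ-≈ (sym (F-small z≤)) (≤-respʳ-≈ 11/6*6/11 (*-monoˡ-≤ (/-nonNegative 11 6) z≤))
  ... | no  z≰ = ≤-respʳ-≈ (sym (F-large z≰)) 0≤1 , ≤-reflexive (F-large z≰)

  F′-small : ∀ {z} → z ≤ 6 / 11 → F′ z ≈ 11 / 6
  F′-small {z} z≤ = reflexive (≡.cong (λ b → if b then 11 / 6 else 0#) (dec-true (z ≤? 6 / 11) z≤))

  F′-large : ∀ {z} → ¬ z ≤ 6 / 11 → F′ z ≈ 0#
  F′-large {z} z≰ = reflexive (≡.cong (λ b → if b then 11 / 6 else 0#) (dec-false (z ≤? 6 / 11) z≰))

  1/1+0≈1 : 1/1+ 0 ≈ 1#
  1/1+0≈1 = trans (sym (*-identityˡ _)) (trans (*-congʳ (sym (+-identityʳ 1#))) (inverseʳ 1))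

  -- A terminal with F(x i) = 1 contributes a factor 1 − t, and ∫ (1 − t) dt = 1/2.
  2*capture≤1 : ∀ {n} (x : Vector Carrier n) → (∀ i → 0# ≤ x i) → ∀ i → ¬ x i ≤ 6 / 11 → fromℕ 2 * capture x ≤ 1#
  2*capture≤1 x 0≤x i x≰ = ≤-respʳ-≈ eq
    (*-monoˡ-≤ (fromℕ-nonNegative 2) (Δ*-≤-Δ (F ∘ x) (F-unit ∘ 0≤x) 1/1+-completelyMonotone i 0))
    where
    eq : fromℕ 2 * (1/1+ 0 - F (x i) * 1/1+ 1) ≈ 1#
    eq = begin
      fromℕ 2 * (1/1+ 0 - F (x i) * 1/1+ 1)
        ≈⟨ *-congˡ (+-cong 1/1+0≈1 (-‿cong (trans (*-congʳ (F-large x≰)) (*-identityˡ _)))) ⟩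
      fromℕ 2 * (1# - 1/1+ 1)
        ≈⟨ solve 3 (λ t o h → t :* (o :- h) := t :* o :- t :* h) refl (fromℕ 2) 1# (1/1+ 1) ⟩
      fromℕ 2 * 1# - fromℕ 2 * 1/1+ 1
        ≈⟨ +-cong (trans (*-identityʳ _) (+-congˡ (+-identityʳ 1#))) (-‿cong (inverseʳ 2)) ⟩
      1# + 1# - 1#
        ≈⟨ trans (+-assoc _ _ _) (trans (+-congˡ (-‿inverseʳ 1#)) (+-identityʳ 1#)) ⟩
      1# ∎

  F′*capture≤11/12 : ∀ z {n} (x : Vector Carrier n) → (∀ i → 0# ≤ x i) → ∀ i → ¬ x i ≤ 6 / 11 → F′ z * capture x ≤ 11 / 12
  F′*capture≤11/12 z x 0≤x i x≰ with z ≤? 6 / 11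
  ... | no  _ = ≤-respˡ-≈ (sym (zeroˡ _)) (/-nonNegative 11 12)
  ... | yes _ = *-cancelˡ-≤ 12 (≤-respˡ-≈ left (≤-respʳ-≈ right (*-monoˡ-≤ (fromℕ-nonNegative 11) (2*capture≤1 x 0≤x i x≰))))
    where
    left : fromℕ 11 * (fromℕ 2 * capture x) ≈ fromℕ 12 * (11 / 6 * capture x)
    left = begin
      fromℕ 11 * (fromℕ 2 * capture x)              ≈⟨ *-congʳ (*-/ 11 6) ⟨
      fromℕ 6 * (11 / 6) * (fromℕ 2 * capture x)
        ≈⟨ solve 4 (λ s k t u → s :* k :* (t :* u) := s :* t :* (k :* u)) refl (fromℕ 6) (11 / 6) (fromℕ 2) (capture x) ⟩
      fromℕ 6 * fromℕ 2 * (11 / 6 * capture x)      ≈⟨ *-congʳ (fromℕ-* 6 2) ⟨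
      fromℕ 12 * (11 / 6 * capture x)               ∎
    right : fromℕ 11 * 1# ≈ fromℕ 12 * (11 / 12)
    right = trans (*-identityʳ _) (sym (*-/ 11 12))

  11/6≤bound : 11 / 6 ≤ 2014096 / 1000000
  11/6≤bound = /-mono-≤ 11 6 2014096 1000000 (ℕ.≤ᵇ⇒≤ (11 ℕ.* 1000000) (2014096 ℕ.* 6) _)

  module _ {n} (x : Vector Carrier (suc (suc n))) (x∈Δ : InSimplex x) where
    open InSimplex x∈Δ

    x₁ x₂ v : Carrier
    x₁ = x zero
    x₂ = x (suc zero)
    v = sum (tail (tail x))

    captures : Carrier
    captures = capture (tail x) + capture (x ∘ punchIn (suc zero))

    captures≤exp : x₁ ≤ 6 / 11 → x₂ ≤ 6 / 11 → (∀ i → x (suc (suc i)) ≤ 6 / 11) →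
      captures ≤ exp 6 (- (11 / 6 * v)) (moment v)
    captures≤exp x₁≤ x₂≤ x≤ = ≤-respʳ-≈ eq (+-mono-≤ (step (suc zero)) (step zero))
      where
      y = F ∘ tail (tail x)
      step : ∀ i → Δ (F (x i)) (Δ* y 1/1+) 0 ≤ exp 6 (- (11 / 6 * v)) (Δ (F (x i)) 1/1+)
      step i = ≤-respˡ-≈ (Δ*-Δ y (F (x i)) 1/1+ 0) (≤-respʳ-≈
        (exp-cong₁ 6 (Δ (F (x i)) 1/1+) (-‿cong (trans (sum-cong-≋ (λ i → F-small (x≤ i))) (sym (*-distribˡ-sum (11 / 6) (tail (tail x)))))))
        (Δ*-≤-exp y (λ i → F-unit (nonNegative (suc (suc i)))) 3
          (Δ-completelyMonotone (F-unit (nonNegative i)) 1/1+-completelyMonotone)))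
      x₁+x₂ : x₁ + x₂ ≈ 1# - v
      x₁+x₂ = trans (solve 3 (λ a b v → a :+ b := (a :+ (b :+ v)) :- v) refl x₁ x₂ v) (+-congʳ sum≈1)
      moments : ∀ j → moment v j ≈ Δ (F x₂) 1/1+ j + 1# * Δ (F x₁) 1/1+ j
      moments j = begin
        fromℕ 2 * 1/1+ j - 11 / 6 * (1# - v) * 1/1+ (suc j)
          ≈⟨ +-cong (*-congʳ (+-congˡ (+-identityʳ 1#))) (-‿cong (*-congʳ (*-congˡ (sym x₁+x₂)))) ⟩
        (1# + 1#) * 1/1+ j - 11 / 6 * (x₁ + x₂) * 1/1+ (suc j)
          ≈⟨ +-cong (trans (distribʳ _ _ _) (+-cong (*-identityˡ _) (*-identityˡ _)))
                    (-‿cong (*-congʳ (trans (distribˡ _ _ _) (+-cong (sym (F-small x₁≤)) (sym (F-small x₂≤)))))) ⟩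
        (1/1+ j + 1/1+ j) - (F x₁ + F x₂) * 1/1+ (suc j)
          ≈⟨ solve 4 (λ i a b k → (i :+ i) :- (a :+ b) :* k := (i :- b :* k) :+ (i :- a :* k)) refl (1/1+ j) (F x₁) (F x₂) (1/1+ (suc j)) ⟩
        Δ (F x₂) 1/1+ j + Δ (F x₁) 1/1+ j
          ≈⟨ +-congˡ (*-identityˡ _) ⟨
        Δ (F x₂) 1/1+ j + 1# * Δ (F x₁) 1/1+ j ∎
      eq : exp 6 (- (11 / 6 * v)) (Δ (F x₂) 1/1+) + exp 6 (- (11 / 6 * v)) (Δ (F x₁) 1/1+) ≈ exp 6 (- (11 / 6 * v)) (moment v)
      eq = trans (+-congˡ (sym (*-identityˡ _))) (sym (exp-linear 6 (- (11 / 6 * v)) 1# moments))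

    v-nonNegative : 0# ≤ v
    v-nonNegative = sum-nonNegative (tail (tail x)) (λ i → nonNegative (suc (suc i)))

    v≤1 : v ≤ 1#
    v≤1 = ≤-respʳ-≈ (trans (solve 3 (λ a b v → v :+ (a :+ b) := a :+ (b :+ v)) refl x₁ x₂ v) sum≈1)
      (x≤x+y (+-nonNegative (nonNegative zero) (nonNegative (suc zero))))

    captures≤1 : ∀ i → ¬ x (suc (suc i)) ≤ 6 / 11 → captures ≤ 1#
    captures≤1 i x≰ = *-cancelˡ-≤ 2 (≤-respˡ-≈ (sym (distribˡ _ _ _))
      (≤-respʳ-≈ (trans (+-congˡ (sym (+-identityʳ 1#))) (sym (*-identityʳ _)))
        (+-mono-≤ (2*capture≤1 (tail x) (nonNegative ∘ suc) (suc i) x≰)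
                  (2*capture≤1 (x ∘ punchIn (suc zero)) (nonNegative ∘ punchIn (suc zero)) (suc i) x≰))))

    captures-bound : x₁ ≤ 6 / 11 → x₂ ≤ 6 / 11 → 11 / 6 * captures ≤ 2014096 / 1000000
    captures-bound x₁≤ x₂≤ = [ bound-if-small , bound-if-large ]′ small-or-large
      where
      small-or-large : (∀ i → x (suc (suc i)) ≤ 6 / 11) ⊎ ∃ λ i → ¬ x (suc (suc i)) ≤ 6 / 11
      small-or-large with Fin.all? (λ i → x (suc (suc i)) ≤? 6 / 11)
      ... | yes x≤ = inj₁ x≤
      ... | no ¬x≤ = inj₂ (Fin.¬∀⟶∃¬ n (λ i → x (suc (suc i)) ≤ 6 / 11) (λ i → x (suc (suc i)) ≤? 6 / 11) ¬x≤)
      bound-if-small : (∀ i → x (suc (suc i)) ≤ 6 / 11) → 11 / 6 * captures ≤ 2014096 / 1000000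
      bound-if-small x≤ = ≤-trans (*-monoˡ-≤ (/-nonNegative 11 6) (captures≤exp x₁≤ x₂≤ x≤)) (exp-moment-bound v v-nonNegative v≤1)
      bound-if-large : (∃ λ i → ¬ x (suc (suc i)) ≤ 6 / 11) → 11 / 6 * captures ≤ 2014096 / 1000000
      bound-if-large (i , x≰) = ≤-trans (≤-respʳ-≈ (*-identityʳ (11 / 6)) (*-monoˡ-≤ (/-nonNegative 11 6) (captures≤1 i x≰))) 11/6≤bound

    density-bound-small : .(2≤k : 2 ℕ.≤ suc (suc n)) → x₁ ≤ 6 / 11 → x₂ ≤ 6 / 11 → d 2≤k x ≤ 2014096 / 1000000
    density-bound-small 2≤k x₁≤ x₂≤ = ≤-respˡ-≈ (sym (trans (density n 2≤k x)
      (trans (+-cong (*-congʳ (F′-small x₁≤)) (*-congʳ (F′-small x₂≤))) (sym (distribˡ _ _ _))))) (captures-bound x₁≤ x₂≤)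

    density-bound-large : .(2≤k : 2 ℕ.≤ suc (suc n)) → ¬ (x₁ ≤ 6 / 11 × x₂ ≤ 6 / 11) → d 2≤k x ≤ 11 / 12
    density-bound-large 2≤k ¬small = [ bound-if-x₁-large , bound-if-x₂-large ]′ x₁-or-x₂-large
      where
      x₁-or-x₂-large : (¬ x₁ ≤ 6 / 11) ⊎ (¬ x₂ ≤ 6 / 11)
      x₁-or-x₂-large with x₁ ≤? 6 / 11
      ... | no x₁≰  = inj₁ x₁≰
      ... | yes x₁≤ = inj₂ (λ x₂≤ → ¬small (x₁≤ , x₂≤))
      bound-if-x₁-large : ¬ x₁ ≤ 6 / 11 → d 2≤k x ≤ 11 / 12
      bound-if-x₁-large x₁≰ = ≤-respˡ-≈
        (sym (trans (density n 2≤k x) (trans (+-congʳ (trans (*-congʳ (F′-large x₁≰)) (zeroˡ _))) (+-identityˡ _))))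
        (F′*capture≤11/12 x₂ (x ∘ punchIn (suc zero)) (nonNegative ∘ punchIn (suc zero)) zero x₁≰)
      bound-if-x₂-large : ¬ x₂ ≤ 6 / 11 → d 2≤k x ≤ 11 / 12
      bound-if-x₂-large x₂≰ = ≤-respˡ-≈
        (sym (trans (density n 2≤k x) (trans (+-congˡ (trans (*-congʳ (F′-large x₂≰)) (zeroˡ _))) (+-identityʳ _))))
        (F′*capture≤11/12 x₁ (tail x) (nonNegative ∘ suc) zero x₂≰)

lemma6p2 : ∀ {c ℓ} (ℝ : RealNumbers c ℓ) →
    let open RealNumbers ℝ
        open Density ℝ
    in
    (k : ℕ) (3≤k : 3 ℕ.≤ k) (x : Vector Carrier k) → InSimplex x →
    let 2≤k = <⇒≤ 3≤k
        x₁  = x (terminal₁ 2≤k)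
        x₂  = x (terminal₂ 2≤k)
    in
    (x₁ ≤ 6 / 11 × x₂ ≤ 6 / 11 → d 2≤k x ≤ 2014096 / 1000000) ×
    (¬ (x₁ ≤ 6 / 11 × x₂ ≤ 6 / 11) → d 2≤k x ≤ 11 / 12)
lemma6p2 ℝ (suc zero) (s≤s ()) x x∈Δ
lemma6p2 ℝ (suc (suc n)) 3≤k x x∈Δ =
  (λ { (x₁≤ , x₂≤) → density-bound-small x x∈Δ (<⇒≤ 3≤k) x₁≤ x₂≤ }) , density-bound-large x x∈Δ (<⇒≤ 3≤k)
  where open Bounds ℝ
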